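{- If there is an output-polynomial time (respectively, a polynomial-delay) algorithm for enumerating all minimal connected vertex covers of $2$-degenerate bipartite graphs, then there is an output-polynomial time (respectively, a polynomial-delay) algorithm for enumerating all minimal transversals of hypergraphs.
   Context: Graphs are finite, undirected and simple. A vertex cover of $G$ is a set $C\subseteq V(G)$ such that every edge has at least one end vertex in $C$; it is connected if $G[C]$ is connected; a connected vertex cover is minimal if no proper subset is a connected vertex cover. A graph is $k$-degenerate if it has a vertex ordering $(v_1,\dots,v_n)$ such that each $v_i$ has at most $k$ neighbors in $G[\{v_i,\dots,v_n\}]$. A transversal of a hypergraph $\mathcal H=(V,\mathcal E)$ is a set $S\subseteq V$ such that each hyperedge $e\in\mathcal E$ contains at least one vertex of $S$; minimality is with respect to inclusion. Enumerating means outputting every such set exactly once. An enumeration algorithm runs in output-polynomial time if its total running time is bounded by a polynomial in the combined size of the input and all outputs; it runs in polynomial delay if the time elapsed between every two consecutive outputs (including pre-processing and post-processing) is bounded by a polynomial in the input size only. -}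

module Defs where

open import Data.Bool.Base using (Bool; true; false)
open import Data.Fin.Base using (Fin)
open import Data.Fin.Permutation using (Permutation′; _⟨$⟩ʳ_; _⟨$⟩ˡ_)
open import Data.Fin.Properties using (_≤?_)
open import Data.Fin.Subset
  using (Subset; _∈_; _∉_; _⊂_; _∩_; ∣_∣; Nonempty)
open import Data.List.Base
  using (List; []; _∷_; _++_; foldr; length; map; replicate; catMaybes)
import Data.List.Membership.Propositional as List
open import Data.List.Relation.Unary.All using (All)
open import Data.List.Relation.Unary.Unique.Propositional using (Unique)
open import Data.Maybe.Base using (Maybe; just; nothing)
open import Data.Nat.Base using (ℕ; suc; _+_; _*_; _≤_)
open import Data.Nat.ListAction using (sum)
open import Data.Nat.Properties using (_≟_)
open import Data.Product.Base using (Σ; ∃-syntax; _×_; _,_)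
open import Data.Sum.Base using (_⊎_)
open import Data.Vec.Base using (tabulate; toList)
open import Function.Bundles using (_⇔_)
open import Relation.Binary.Construct.Closure.ReflexiveTransitive using (Star)
open import Relation.Binary.PropositionalEquality using (_≡_; _≢_)
open import Relation.Nullary.Decidable.Core using (does; yes; no)
open import Relation.Nullary.Negation.Core using (¬_)

------------------------------------------------------------------------
-- Graphs and hypergraphs

record Graph : Set where
  field
    order      : ℕ
    neighbours : Fin order → Subset order
    symmetric  : ∀ {u v} → u ∈ neighbours v → v ∈ neighbours u
    loopless   : ∀ v → v ∉ neighbours v

  Adjacent : Fin order → Fin order → Set
  Adjacent u v = v ∈ neighbours u

record Hypergraph : Set where
  field
    order    : ℕ
    edges    : List (Subset order)
    distinct : Unique edges

Minimal : ∀ {n} → (Subset n → Set) → Subset n → Set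
Minimal P S = P S × (∀ T → T ⊂ S → ¬ P T)

module _ (G : Graph) where
  open Graph G

  IsVertexCover : Subset order → Set
  IsVertexCover C = ∀ {u v} → Adjacent u v → u ∈ C ⊎ v ∈ C

  AdjacentWithin : Subset order → Fin order → Fin order → Set
  AdjacentWithin C u v = u ∈ C × v ∈ C × Adjacent u v

  -- The empty set counts as connected; for vertex covers this matters only
  -- if the graph has no edges, and then the unique minimal one is ∅.
  InducesConnected : Subset order → Set
  InducesConnected C = ∀ {u v} → u ∈ C → v ∈ C → Star (AdjacentWithin C) u v

  IsConnectedVertexCover : Subset order → Set
  IsConnectedVertexCover C = IsVertexCover C × InducesConnected C

  IsBipartite : Set
  IsBipartite =
    Σ (Fin order → Bool) λ side → ∀ {u v} → Adjacent u v → side u ≢ side v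

  -- σ ⟨$⟩ʳ i is the i-th vertex of the ordering, σ ⟨$⟩ˡ v the position of v.
  IsDegenerate : ℕ → Set
  IsDegenerate k =
    Σ (Permutation′ order) λ σ → ∀ i →
      ∣ neighbours (σ ⟨$⟩ʳ i) ∩ tabulate (λ v → does (i ≤? (σ ⟨$⟩ˡ v))) ∣ ≤ k

IsTransversal : (H : Hypergraph) → Subset (Hypergraph.order H) → Set
IsTransversal H S = ∀ {e} → e List.∈ Hypergraph.edges H → Nonempty (e ∩ S)

------------------------------------------------------------------------
-- Model of computation: Jones' WHILE language over binary trees
-- (N. D. Jones, "Computability and Complexity", 1997), extended by an
-- output command.  Every operation of an expression costs one step, as trees
-- are passed by reference.  Up to polynomial factors, also in the delay, this
-- agrees with random access machines at logarithmic cost: a memory can be kept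
-- in a search tree, and conversely trees can be represented by pointers.

infixr 5 _∙_
data Tree : Set where
  nil : Tree
  _∙_ : Tree → Tree → Tree

size : Tree → ℕ
size nil     = 1
size (s ∙ t) = suc (size s + size t)

head tail : Tree → Tree
head nil     = nil
head (s ∙ t) = s
tail nil     = nil
tail (s ∙ t) = t

Var : Set
Var = ℕ

Store : Set
Store = Var → Tree

_[_↦_] : Store → Var → Tree → Store
(s [ x ↦ t ]) y with y ≟ x
... | yes _ = t
... | no  _ = s y

data Expr : Set where
  var   : Var → Expr
  nil   : Expr
  cons  : Expr → Expr → Expr
  hd tl : Expr → Expr

eval : Expr → Store → Tree
eval (var x)    s = s x
eval nil        s = nil
eval (cons e f) s = eval e s ∙ eval f s
eval (hd e)     s = head (eval e s)
eval (tl e)     s = tail (eval e s)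

cost : Expr → ℕ
cost (var x)    = 1
cost nil        = 1
cost (cons e f) = suc (cost e + cost f)
cost (hd e)     = suc (cost e)
cost (tl e)     = suc (cost e)

infixr 4 _⨾_
infix  5 _≔_
data Program : Set where
  skip          : Program
  _≔_           : Var → Expr → Program
  _⨾_           : Program → Program → Program
  if_then_else_ : Expr → Program → Program → Program
  while_loop_     : Expr → Program → Program
  output        : Expr → Program

-- One entry per time step; `just t` is a step in which the output of t is
-- completed.
Trace : Set
Trace = List (Maybe Tree)

steps : ℕ → Trace
steps n = replicate n nothing

-- Outputting a tree takes time proportional to its size, even though its
-- subtrees may be shared in memory.
infix 3 ⟨_,_⟩⇓⟨_,_⟩
data ⟨_,_⟩⇓⟨_,_⟩ : Program → Store → Trace → Store → Set where
  skip : ∀ {s} → ⟨ skip , s ⟩⇓⟨ steps 1 , s ⟩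

  assign : ∀ {x e s} →
    ⟨ x ≔ e , s ⟩⇓⟨ steps (cost e) , s [ x ↦ eval e s ] ⟩

  seq : ∀ {p q s s′ s″ τ τ′} →
    ⟨ p , s ⟩⇓⟨ τ , s′ ⟩ → ⟨ q , s′ ⟩⇓⟨ τ′ , s″ ⟩ →
    ⟨ p ⨾ q , s ⟩⇓⟨ τ ++ τ′ , s″ ⟩

  if-true : ∀ {e p q s s′ τ} → eval e s ≢ nil →
    ⟨ p , s ⟩⇓⟨ τ , s′ ⟩ →
    ⟨ if e then p else q , s ⟩⇓⟨ steps (cost e) ++ τ , s′ ⟩

  if-false : ∀ {e p q s s′ τ} → eval e s ≡ nil →
    ⟨ q , s ⟩⇓⟨ τ , s′ ⟩ →
    ⟨ if e then p else q , s ⟩⇓⟨ steps (cost e) ++ τ , s′ ⟩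

  while-true : ∀ {e p s s′ s″ τ τ′} → eval e s ≢ nil →
    ⟨ p , s ⟩⇓⟨ τ , s′ ⟩ → ⟨ while e loop p , s′ ⟩⇓⟨ τ′ , s″ ⟩ →
    ⟨ while e loop p , s ⟩⇓⟨ steps (cost e) ++ τ ++ τ′ , s″ ⟩

  while-false : ∀ {e p s} → eval e s ≡ nil →
    ⟨ while e loop p , s ⟩⇓⟨ steps (cost e) , s ⟩

  output : ∀ {e s} →
    ⟨ output e , s ⟩⇓⟨ steps (cost e + size (eval e s))
                        ++ just (eval e s) ∷ [] , s ⟩

initial : Tree → Store
initial t = (λ _ → nil) [ 0 ↦ t ]

-- The program, started on the given input in variable 0, halts with this trace.
Run : Program → Tree → Trace → Set
Run p t τ = ∃[ s ] ⟨ p , initial t ⟩⇓⟨ τ , s ⟩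

outputs : Trace → List Tree
outputs = catMaybes

time : Trace → ℕ
time = length

outputSize : Trace → ℕ
outputSize τ = sum (map size (outputs τ))

delaysAfter : ℕ → Trace → List ℕ
delaysAfter d []            = d ∷ []
delaysAfter d (nothing ∷ τ) = delaysAfter (suc d) τ
delaysAfter d (just _  ∷ τ) = suc d ∷ delaysAfter 0 τ

-- The times from the start to the first output, between consecutive outputs,
-- and from the last output to the end.
delays : Trace → List ℕ
delays = delaysAfter 0

------------------------------------------------------------------------
-- Polynomials in one variable with natural coefficients

data Polynomial : Set where
  const   : ℕ → Polynomial
  X       : Polynomial
  _⊕_ _⊗_ : Polynomial → Polynomial → Polynomial

⟦_⟧ : Polynomial → ℕ → ℕ
⟦ const c ⟧ n = c
⟦ X       ⟧ n = n
⟦ f ⊕ g   ⟧ n = ⟦ f ⟧ n + ⟦ g ⟧ n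
⟦ f ⊗ g   ⟧ n = ⟦ f ⟧ n * ⟦ g ⟧ n

------------------------------------------------------------------------
-- Enumeration problems

encodeBool : Bool → Tree
encodeBool true  = nil ∙ nil
encodeBool false = nil

encodeList : List Tree → Tree
encodeList = foldr _∙_ nil

encodeSubset : ∀ {n} → Subset n → Tree
encodeSubset S = encodeList (map encodeBool (toList S))

encodeUnary : ℕ → Tree
encodeUnary n = encodeList (replicate n nil)

-- Adjacency matrix.
encodeGraph : Graph → Tree
encodeGraph G = encodeList (toList (tabulate λ v → encodeSubset (neighbours v)))
  where open Graph G

-- The order, in unary since the vertex set is part of the input, followed by
-- the incidence matrix.
encodeHypergraph : Hypergraph → Tree
encodeHypergraph H = encodeUnary order ∙ encodeList (map encodeSubset edges)
  where open Hypergraph H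

record EnumerationProblem : Set₁ where
  field
    Instance   : Set
    encode     : Instance → Tree
    ground     : Instance → ℕ
    IsSolution : (I : Instance) → Subset (ground I) → Set

module _ (𝒫 : EnumerationProblem) where
  open EnumerationProblem 𝒫

  inputSize : Instance → ℕ
  inputSize I = size (encode I)

  Enumerates : Instance → Trace → Set
  Enumerates I τ = Σ (List (Subset (ground I))) λ Ss →
    outputs τ ≡ map encodeSubset Ss ×
    Unique Ss ×
    (∀ S → S List.∈ Ss ⇔ IsSolution I S)

  HasOutputPolynomialAlgorithm : Set
  HasOutputPolynomialAlgorithm =
    Σ Program λ p → Σ Polynomial λ f → ∀ I → ∃[ τ ]
      Run p (encode I) τ × Enumerates I τ ×
      time τ ≤ ⟦ f ⟧ (inputSize I + outputSize τ)

  HasPolynomialDelayAlgorithm : Set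
  HasPolynomialDelayAlgorithm =
    Σ Program λ p → Σ Polynomial λ f → ∀ I → ∃[ τ ]
      Run p (encode I) τ × Enumerates I τ ×
      All (_≤ ⟦ f ⟧ (inputSize I)) (delays τ)

-- The programs receive only the graph, not the witnesses of bipartiteness
-- and degeneracy.
MinimalConnectedVertexCovers : (Graph → Set) → EnumerationProblem
MinimalConnectedVertexCovers Class = record
  { Instance   = Σ Graph Class
  ; encode     = λ (G , _) → encodeGraph G
  ; ground     = λ (G , _) → Graph.order G
  ; IsSolution = λ (G , _) → Minimal (IsConnectedVertexCover G)
  }

TwoDegenerateBipartite : Graph → Set
TwoDegenerateBipartite G = IsDegenerate G 2 × IsBipartite G

MinimalTransversals : EnumerationProblem
MinimalTransversals = record
  { Instance   = Hypergraph
  ; encode     = encodeHypergraph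
  ; ground     = Hypergraph.order
  ; IsSolution = λ H → Minimal (IsTransversal H)
  }

{-# OPTIONS --safe #-}
-- Let G have a middle vertex for every pair of a hyperedge and an element, with
-- a pendant neighbour each; a star vertex for every hyperedge, adjacent to all
-- middle vertices of its row; and a vertex for every element, adjacent to the
-- middle vertices of the hyperedges containing it.  A connected vertex cover of
-- G contains all middle vertices because of the pendants, and all star vertices
-- because of two dummy columns.  Each row then is one connected piece, so with
-- a row for the full hyperedge added the cover is connected exactly if the
-- chosen elements meet every hyperedge.  Hence the minimal connected vertex
-- covers are the minimal transversals plus all middle and star vertices.  In the
-- order pendants, middles, stars, elements every vertex has at most two later
-- neighbours, and a transversal is read off a cover by dropping a prefix.
module Submission where

open import Defs
open import Data.Bool.Base using (Bool; true; false; _∧_; _∨_)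
open import Data.Bool.Properties using (∨-comm)
open import Data.Fin.Base as Fin using (Fin; zero; suc; toℕ)
import Data.Fin.Permutation as Permutation
import Data.Fin.Properties as Fin
open import Data.Fin.Subset
  using (Subset; inside; outside; _∈_; _∉_; _⊆_; _∪_; ∣_∣; ⁅_⁆)
open import Data.Fin.Subset.Properties
  using (⊆-antisym; p⊆q⇒∣p∣≤∣q∣; ∣⁅x⁆∣≡1; x∈⁅x⁆; x∈p∪q⁺; x∈p∩q⁺; x∈p∩q⁻; _∈?_)
open import Data.List.Base as List
  using (List; []; _∷_; _++_; concat; length; map; allFin; cartesianProductWith)
import Data.List.Membership.Propositional as List
open import Data.List.Membership.Propositional.Properties
  using (∈-++⁺ˡ; ∈-++⁺ʳ; ∈-map⁺; ∈-map⁻; ∈-allFin; ∈-cartesianProductWith⁺; ∈-lookup)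
open import Data.List.Properties
  using (++-assoc; catMaybes-++; length-++; length-map; length-replicate; length-tabulate;
         map-++; map-∘; map-cong; map-tabulate; tabulate-cong; tabulate-lookup)
open import Data.List.Relation.Unary.All as All using (All; []; _∷_)
import Data.List.Relation.Unary.All.Properties as All
open import Data.List.Relation.Unary.AllPairs using (AllPairs; []; _∷_)
import Data.List.Relation.Unary.AllPairs.Properties as AllPairs
open import Data.List.Relation.Unary.Any as Any using (here; there)
open import Data.List.Relation.Unary.Any.Properties using (lookup-index)
open import Data.List.Relation.Unary.Unique.Propositional using (Unique)
import Data.List.Relation.Unary.Unique.Propositional.Properties as Unique
open import Data.Maybe.Base using (just; nothing)
open import Data.Nat.Base
  using (ℕ; zero; suc; _+_; _*_; _∸_; _⊔_; _≤_; _<_; _≡ᵇ_; z≤n; s≤s; s<s⁻¹)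
open import Data.Nat.ListAction using (sum)
open import Data.Nat.Properties
open import Data.Nat.Tactic.RingSolver using (solve-∀)
open import Data.Product.Base using (∃-syntax; _×_; _,_; proj₁; proj₂)
open import Data.Sum.Base as Sum using (_⊎_; inj₁; inj₂; swap)
open import Data.Vec.Base as Vec using (Vec; []; _∷_; tabulate; toList)
open import Data.Vec.Properties
  using (lookup∘tabulate; tabulate∘lookup; lookup⇒[]=; []=⇒lookup)
open import Function.Base using (_∘_; id)
open import Function.Bundles using (mk⇔; Equivalence)
open import Relation.Binary.Construct.Closure.ReflexiveTransitive
  using (Star; ε; _◅_; _◅◅_; reverse)
open import Relation.Binary.Definitions using (tri<; tri≈; tri>)
open import Relation.Binary.PropositionalEquality
open import Relation.Nullary.Decidable using (Dec; does; yes; no; does-⇔)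
open import Relation.Nullary.Negation.Core using (¬_; contradiction)

-- Polynomial-time functions on trees

-- Polynomial delay forbids collecting solutions before translating them, so the given program is
-- rewritten: each `output` command decodes its tree and outputs the result at once. As the two
-- kinds of solutions are in bijection, nothing has to be filtered or remembered. The decoder needs
-- one datum of the instance, the number of vertices before the elements, which is kept in a fresh
-- variable.
--
-- Without its pendant, a middle vertex could be left out of a cover whenever its star and its
-- element are chosen; without the dummy columns, a star could be left out when its row is held
-- together by elements. Both would spoil the bijection. The degenerate hypergraphs fit as well: the
-- row of an empty hyperedge has no exit, so the graph has no connected vertex cover, and without
-- hyperedges the full row alone remains, which its star connects.

⟦_⟧-mono : ∀ f {m n} → m ≤ n → ⟦ f ⟧ m ≤ ⟦ f ⟧ n
⟦ const c ⟧-mono m≤n = ≤-refl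
⟦ X ⟧-mono m≤n = m≤n
⟦ f ⊕ g ⟧-mono m≤n = +-mono-≤ (⟦ f ⟧-mono m≤n) (⟦ g ⟧-mono m≤n)
⟦ f ⊗ g ⟧-mono m≤n = *-mono-≤ (⟦ f ⟧-mono m≤n) (⟦ g ⟧-mono m≤n)

infixr 9 _⊚_
_⊚_ : Polynomial → Polynomial → Polynomial
const c ⊚ g = const c
X       ⊚ g = g
(e ⊕ f) ⊚ g = (e ⊚ g) ⊕ (f ⊚ g)
(e ⊗ f) ⊚ g = (e ⊚ g) ⊗ (f ⊚ g)

⟦⊚⟧ : ∀ f g n → ⟦ f ⊚ g ⟧ n ≡ ⟦ f ⟧ (⟦ g ⟧ n)
⟦⊚⟧ (const c) g n = refl
⟦⊚⟧ X         g n = refl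
⟦⊚⟧ (e ⊕ f)   g n = cong₂ _+_ (⟦⊚⟧ e g n) (⟦⊚⟧ f g n)
⟦⊚⟧ (e ⊗ f)   g n = cong₂ _*_ (⟦⊚⟧ e g n) (⟦⊚⟧ f g n)

-- Natural coefficients make polynomials monotone, so a size estimate may be inserted into a time
-- bound.
⊚-bound : ∀ f g {m n} → m ≤ ⟦ g ⟧ n → ⟦ f ⟧ m ≤ ⟦ f ⊚ g ⟧ n
⊚-bound f g {n = n} m≤ = ≤-trans (⟦ f ⟧-mono m≤) (≤-reflexive (sym (⟦⊚⟧ f g n)))

update-same : ∀ s x t → (s [ x ↦ t ]) x ≡ t
update-same s x t with x ≟ x
... | yes _   = refl
... | no  x≢x = contradiction refl x≢x

update-other : ∀ s {x y} t → y ≢ x → (s [ x ↦ t ]) y ≡ s y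
update-other s {x} {y} t y≢x with y ≟ x
... | yes y≡x = contradiction y≡x y≢x
... | no  _   = refl

update-below : ∀ s {x y} t → y < x → (s [ x ↦ t ]) y ≡ s y
update-below s t y<x = update-other s t (<⇒≢ y<x)

steps-+ : ∀ m {n} → steps m ++ steps n ≡ steps (m + n)
steps-+ zero    = refl
steps-+ (suc m) = cong (nothing ∷_) (steps-+ m)

infixr 4 _then_
_then_ : ∀ {p q s s′ s″ m n} →
  ⟨ p , s ⟩⇓⟨ steps m , s′ ⟩ → ⟨ q , s′ ⟩⇓⟨ steps n , s″ ⟩ →
  ⟨ p ⨾ q , s ⟩⇓⟨ steps (m + n) , s″ ⟩
_then_ {m = m} P Q = subst (λ τ → ⟨ _ , _ ⟩⇓⟨ τ , _ ⟩) (steps-+ m) (seq P Q)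

-- A stack discipline: `k` holds argument and result, larger variables are scratch, and `frame`
-- protects smaller ones. This lets programs be nested at increasing `k` without renaming.
record Evaluates (p : Program) (k : Var) (s : Store) (t : Tree) (b : ℕ) : Set where
  constructor evaluation
  field
    {duration} : ℕ
    {final}    : Store
    run        : ⟨ p , s ⟩⇓⟨ steps duration , final ⟩
    result     : final k ≡ t
    frame      : ∀ {j} → j < k → final j ≡ s j
    fast       : duration ≤ b

-- The time bound does not control the size of the result: `cons` shares subtrees, so a few steps
-- can double a tree. Composition therefore needs `sizeBound`.
record PolyTime (f : Tree → Tree) : Set where
  field
    program     : Var → Program
    timeBound   : Polynomial
    sizeBound   : Polynomial
    evaluatesAt : ∀ k s {t} → s k ≡ t →
      Evaluates (program k) k s (f t) (⟦ timeBound ⟧ (size t))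
    small       : ∀ t → size (f t) ≤ ⟦ sizeBound ⟧ (size t)

open PolyTime

PolyTime-resp-≗ : ∀ {f g} → f ≗ g → PolyTime f → PolyTime g
PolyTime-resp-≗ f≗g F = record
  { program     = program F
  ; timeBound   = timeBound F
  ; sizeBound   = sizeBound F
  ; evaluatesAt = λ k s {t} eq →
      subst (λ r → Evaluates (program F k) k s r (⟦ timeBound F ⟧ (size t)))
        (f≗g t) (evaluatesAt F k s eq)
  ; small       = λ t → subst (λ r → size r ≤ _) (f≗g t) (small F t)
  }

size-head : ∀ t → size (head t) ≤ size t
size-head nil     = ≤-refl
size-head (s ∙ t) = ≤-trans (m≤m+n (size s) (size t)) (n≤1+n _)

size-tail : ∀ t → size (tail t) ≤ size t
size-tail nil     = ≤-refl
size-tail (s ∙ t) = ≤-trans (m≤n+m (size t) (size s)) (n≤1+n _)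

idᶠ : PolyTime (λ t → t)
idᶠ = record
  { program     = λ k → skip
  ; timeBound   = const 1
  ; sizeBound   = X
  ; evaluatesAt = λ k s eq → evaluation skip eq (λ _ → refl) ≤-refl
  ; small       = λ t → ≤-refl
  }

nilᶠ : PolyTime (λ t → nil)
nilᶠ = record
  { program     = λ k → k ≔ nil
  ; timeBound   = const 1
  ; sizeBound   = const 1
  ; evaluatesAt = λ k s eq →
      evaluation assign (update-same s k _) (update-below s _) ≤-refl
  ; small       = λ t → ≤-refl
  }

infixr 9 _∘ᶠ_
_∘ᶠ_ : ∀ {g f} → PolyTime g → PolyTime f → PolyTime (λ t → g (f t))
_∘ᶠ_ {g} {f} G F = record
  { program     = λ k → program F k ⨾ program G k
  ; timeBound   = timeBound F ⊕ (timeBound G ⊚ sizeBound F)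
  ; sizeBound   = sizeBound G ⊚ sizeBound F
  ; evaluatesAt = λ k s {t} eq →
      let module A = Evaluates (evaluatesAt F k s eq)
          module B = Evaluates (evaluatesAt G k A.final A.result)
      in evaluation (A.run then B.run) B.result
           (λ j<k → trans (B.frame j<k) (A.frame j<k))
           (+-mono-≤ A.fast (≤-trans B.fast (⊚-bound (timeBound G) (sizeBound F) (small F t))))
  ; small       = λ t →
      ≤-trans (small G (f t)) (⊚-bound (sizeBound G) (sizeBound F) (small F t))
  }

private
  hdᶠ : PolyTime head
  hdᶠ = record
    { program     = λ k → k ≔ hd (var k)
    ; timeBound   = const 2
    ; sizeBound   = X
    ; evaluatesAt = λ k s eq →
        evaluation assign (trans (update-same s k _) (cong head eq)) (update-below s _) ≤-refl
    ; small       = size-head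
    }

  tlᶠ : PolyTime tail
  tlᶠ = record
    { program     = λ k → k ≔ tl (var k)
    ; timeBound   = const 2
    ; sizeBound   = X
    ; evaluatesAt = λ k s eq →
        evaluation assign (trans (update-same s k _) (cong tail eq)) (update-below s _) ≤-refl
    ; small       = size-tail
    }

headᶠ : ∀ {f} → PolyTime f → PolyTime (λ t → head (f t))
headᶠ F = hdᶠ ∘ᶠ F

tailᶠ : ∀ {f} → PolyTime f → PolyTime (λ t → tail (f t))
tailᶠ F = tlᶠ ∘ᶠ F

infixr 5 _∙ᶠ_
_∙ᶠ_ : ∀ {f g} → PolyTime f → PolyTime g → PolyTime (λ t → f t ∙ g t)
_∙ᶠ_ {f} {g} F G = record
  { program     = λ k →
      -- Each component works on its own copy of the argument: `F` at `1 + k` preserves the argument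
      -- in `k`, and `G` at `2 + k` preserves the value of `F` in `1 + k`.
      (1 + k ≔ var k) ⨾ program F (1 + k) ⨾ (2 + k ≔ var k) ⨾ program G (2 + k) ⨾
      k ≔ cons (var (1 + k)) (var (2 + k))
  ; timeBound   = const 5 ⊕ (timeBound F ⊕ timeBound G)
  ; sizeBound   = const 1 ⊕ (sizeBound F ⊕ sizeBound G)
  ; evaluatesAt = at
  ; small       = λ t → s≤s (+-mono-≤ (small F t) (small G t))
  }
  where
  at : ∀ k s {t} → s k ≡ t → Evaluates _ k s (f t ∙ g t) _
  at k s {t} eq = evaluation
    (assign then A.run then assign then B.run then assign)
    (trans (update-same B.final k _) (cong₂ _∙_ left B.result))
    (λ {j} j<k → begin
      (B.final [ k ↦ _ ]) j     ≡⟨ update-below B.final _ j<k ⟩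
      B.final j                 ≡⟨ B.frame (m<n⇒m<1+n (m<n⇒m<1+n j<k)) ⟩
      (A.final [ 2 + k ↦ _ ]) j ≡⟨ update-below A.final _ (m<n⇒m<1+n (m<n⇒m<1+n j<k)) ⟩
      A.final j                 ≡⟨ A.frame (m<n⇒m<1+n j<k) ⟩
      (s [ 1 + k ↦ _ ]) j       ≡⟨ update-below s _ (m<n⇒m<1+n j<k) ⟩
      s j ∎)
    (≤-trans (≤-reflexive (reorder A.duration B.duration))
      (+-monoʳ-≤ 5 (+-mono-≤ A.fast B.fast)))
    where
    open ≡-Reasoning
    module A = Evaluates (evaluatesAt F (1 + k) (s [ 1 + k ↦ s k ])
                 (trans (update-same s (1 + k) _) eq))
    kept : A.final k ≡ t
    kept = trans (A.frame (n<1+n k)) (trans (update-below s _ (n<1+n k)) eq)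
    module B = Evaluates (evaluatesAt G (2 + k) (A.final [ 2 + k ↦ A.final k ])
                 (trans (update-same A.final (2 + k) _) kept))
    left : B.final (1 + k) ≡ f t
    left = trans (B.frame (n<1+n _)) (trans (update-below A.final _ (n<1+n _)) A.result)
    reorder : ∀ a b → 1 + (a + (1 + (b + 3))) ≡ 5 + (a + b)
    reorder = solve-∀

cond : Tree → Tree → Tree → Tree
cond nil     x y = y
cond (_ ∙ _) x y = x

condᶠ : ∀ {f g h} → PolyTime f → PolyTime g → PolyTime h →
  PolyTime (λ t → cond (f t) (g t) (h t))
condᶠ {f} {g} {h} F G H = record
  { program     = λ k → (1 + k ≔ var k) ⨾ program F (1 + k) ⨾
      if var (1 + k) then program G k else program H k
  -- Two steps for the copy and the test. The sum of both branches stands in for their maximum,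
  -- which is not a polynomial.
  ; timeBound   = const 2 ⊕ (timeBound F ⊕ (timeBound G ⊕ timeBound H))
  ; sizeBound   = sizeBound G ⊕ sizeBound H
  ; evaluatesAt = at
  ; small       = smaller
  }
  where
  smaller : ∀ t → size (cond (f t) (g t) (h t)) ≤ _
  smaller t with f t
  ... | nil   = ≤-trans (small H t) (m≤n+m _ _)
  ... | _ ∙ _ = ≤-trans (small G t) (m≤m+n _ _)

  at : ∀ k s {t} → s k ≡ t → Evaluates _ k s (cond (f t) (g t) (h t)) _
  at k s {t} eq = branch (f t) A.result
    where
    module A = Evaluates (evaluatesAt F (1 + k) (s [ 1 + k ↦ s k ])
                 (trans (update-same s (1 + k) _) eq))
    below : ∀ {j} → j < 1 + k → A.final j ≡ s j
    below j<1+k = trans (A.frame j<1+k) (update-below s _ j<1+k)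
    module B = Evaluates (evaluatesAt G k A.final (trans (below (n<1+n k)) eq))
    module C = Evaluates (evaluatesAt H k A.final (trans (below (n<1+n k)) eq))
    reorder : ∀ a b → 1 + (a + (1 + b)) ≡ 2 + (a + b)
    reorder = solve-∀
    branch : ∀ r → A.final (1 + k) ≡ r → Evaluates _ k s (cond r (g t) (h t)) _
    branch nil e = evaluation (assign then A.run then if-false e C.run) C.result
      (λ j<k → trans (C.frame j<k) (below (m<n⇒m<1+n j<k)))
      (≤-trans (≤-reflexive (reorder A.duration C.duration))
        (+-monoʳ-≤ 2 (+-mono-≤ A.fast (≤-trans C.fast (m≤n+m _ _)))))
    branch (_ ∙ _) e = evaluation
      (assign then A.run then if-true (λ n → contradiction (trans (sym e) n) λ ()) B.run) B.result
      (λ j<k → trans (B.frame j<k) (below (m<n⇒m<1+n j<k)))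
      (≤-trans (≤-reflexive (reorder A.duration B.duration))
        (+-monoʳ-≤ 2 (+-mono-≤ A.fast (≤-trans B.fast (m≤m+n _ _)))))

iter : (Tree → Tree) → Tree → Tree → Tree
iter g nil      c = c
iter g (x ∙ xs) c = iter g xs (g ((x ∙ xs) ∙ c))

-- Iterating a polynomial-time function may double the accumulator in every
-- round; the potential Φ excludes this.
module _ {g} (G : PolyTime g) (Φ : Tree → Tree → ℕ) (P : Polynomial)
  (dominates : ∀ xs c → size c ≤ Φ xs c)
  (decreases : ∀ x xs c → Φ xs (g ((x ∙ xs) ∙ c)) ≤ Φ (x ∙ xs) c)
  (bounded   : ∀ t → Φ (head t) (tail t) ≤ ⟦ P ⟧ (size t))
  where

  private
    body : PolyTime (λ t → tail (head t) ∙ g t)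
    body = tailᶠ (headᶠ idᶠ) ∙ᶠ G

    loopTime : ℕ → Tree → ℕ
    loopTime M xs = size xs * (2 + ⟦ timeBound body ⟧ (suc M))

    -- The invariant `size xs + Φ xs c ≤ M` bounds the state in every round, so each round has the
    -- same time bound, and there are at most `size xs` rounds.
    run-loop : ∀ k M xs c s → s k ≡ xs ∙ c → size xs + Φ xs c ≤ M →
      Evaluates (while hd (var k) loop program body k) k s
        (nil ∙ iter g xs c) (2 + loopTime M xs)
    run-loop k M nil c s eq h =
      evaluation (while-false (cong head eq)) eq (λ _ → refl) (m≤m+n 2 _)
    run-loop k M (x ∙ xs) c s eq h = evaluation
      (subst (λ τ → ⟨ while hd (var k) loop program body k , s ⟩⇓⟨ τ , B.final ⟩)
        (cong (λ τ → nothing ∷ nothing ∷ τ) (steps-+ A.duration))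
        (while-true (λ n → contradiction (trans (sym (cong head eq)) n) λ ()) A.run B.run))
      B.result
      (λ j<k → trans (B.frame j<k) (A.frame j<k))
      (begin
        2 + (A.duration + B.duration)
          ≤⟨ +-monoʳ-≤ 2 (+-mono-≤ (≤-trans A.fast (⟦ timeBound body ⟧-mono state≤)) B.fast) ⟩
        2 + (T + (2 + size xs * (2 + T)))
          ≡⟨ reorder T (size xs * (2 + T)) ⟩
        2 + ((2 + T) + size xs * (2 + T))
          ≤⟨ +-monoʳ-≤ 2 (+-monoʳ-≤ (2 + T)
               (*-monoˡ-≤ (2 + T) (m≤n+m (size xs) (size x)))) ⟩
        2 + loopTime M (x ∙ xs) ∎)
      where
      open ≤-Reasoning
      T = ⟦ timeBound body ⟧ (suc M)
      reorder : ∀ a b → 2 + (a + (2 + b)) ≡ 2 + ((2 + a) + b)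
      reorder = solve-∀
      state≤ : size ((x ∙ xs) ∙ c) ≤ suc M
      state≤ = s≤s (≤-trans (+-monoʳ-≤ (size (x ∙ xs)) (dominates (x ∙ xs) c)) h)
      module A = Evaluates (evaluatesAt body k s eq)
      module B = Evaluates (run-loop k M xs (g ((x ∙ xs) ∙ c)) A.final A.result
        (≤-trans (+-mono-≤ (size-tail (x ∙ xs)) (decreases x xs c)) h))

    Φ-iter : ∀ xs c → size (iter g xs c) ≤ Φ xs c
    Φ-iter nil      c = dominates nil c
    Φ-iter (x ∙ xs) c = ≤-trans (Φ-iter xs _) (decreases x xs c)

  iterᶠ : PolyTime (λ t → iter g (head t) (tail t))
  iterᶠ = record
    { program     = λ k → program (headᶠ idᶠ ∙ᶠ tailᶠ idᶠ) k ⨾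
        (while hd (var k) loop program body k) ⨾ k ≔ tl (var k)
    -- Of the 4 steps, two pay for the failing last test and two for the final projection; `X`
    -- bounds the number of rounds.
    ; timeBound   = timeBound (headᶠ idᶠ ∙ᶠ tailᶠ idᶠ) ⊕ (const 4 ⊕
        (X ⊗ (const 2 ⊕ (timeBound body ⊚ (const 1 ⊕ (X ⊕ P))))))
    ; sizeBound   = P
    ; evaluatesAt = at
    ; small       = λ t → ≤-trans (Φ-iter (head t) (tail t)) (bounded t)
    }
    where
    at : ∀ k s {t} → s k ≡ t → Evaluates _ k s (iter g (head t) (tail t)) _
    at k s {t} eq = evaluation (A.run then B.run then assign)
      (trans (update-same B.final k _) (cong tail B.result))
      (λ j<k → trans (update-below B.final _ j<k) (trans (B.frame j<k) (A.frame j<k)))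
      (+-mono-≤ A.fast (begin
        B.duration + 2
          ≡⟨ +-comm B.duration 2 ⟩
        2 + B.duration
          ≤⟨ +-monoʳ-≤ 2 B.fast ⟩
        4 + loopTime M (head t)
          ≤⟨ +-monoʳ-≤ 4 (*-mono-≤ (size-head t) (+-monoʳ-≤ 2
               (⊚-bound (timeBound body) (const 1 ⊕ (X ⊕ P)) ≤-refl))) ⟩
        _ ∎))
      where
      open ≤-Reasoning
      M = size t + ⟦ P ⟧ (size t)
      module A = Evaluates (evaluatesAt (headᶠ idᶠ ∙ᶠ tailᶠ idᶠ) k s eq)
      module B = Evaluates (run-loop k M (head t) (tail t) A.final A.result
        (+-mono-≤ (size-head t) (bounded t)))

-- With lists standing for their lengths this is truncated subtraction. It serves both to drop the
-- prefix of a cover and to compare lengths.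
skip-along : Tree → Tree → Tree
skip-along nil     t = t
skip-along (_ ∙ s) t = skip-along s (tail t)

skip-alongᶠ : ∀ {f g} → PolyTime f → PolyTime g → PolyTime (λ t → skip-along (f t) (g t))
skip-alongᶠ F G = PolyTime-resp-≗ (λ t → same (head t) (tail t))
    (iterᶠ (tailᶠ (tailᶠ idᶠ)) (λ xs c → size c) X
      (λ _ _ → ≤-refl) (λ _ _ c → size-tail c) size-tail)
  ∘ᶠ (F ∙ᶠ G)
  where
  same : ∀ xs c → iter (λ t → tail (tail t)) xs c ≡ skip-along xs c
  same nil      c = refl
  same (x ∙ xs) c = same xs (tail c)

infixr 5 _⧺_
_⧺_ : Tree → Tree → Tree
nil     ⧺ t = t
(x ∙ s) ⧺ t = x ∙ (s ⧺ t)

⧺-identityʳ : ∀ t → t ⧺ nil ≡ t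
⧺-identityʳ nil     = refl
⧺-identityʳ (x ∙ t) = cong (x ∙_) (⧺-identityʳ t)

reverse-onto : Tree → Tree → Tree
reverse-onto nil     t = t
reverse-onto (x ∙ s) t = reverse-onto s (x ∙ t)

reverse-onto-⧺ : ∀ r s t → reverse-onto (r ⧺ s) t ≡ reverse-onto s (reverse-onto r t)
reverse-onto-⧺ nil     s t = refl
reverse-onto-⧺ (x ∙ r) s t = reverse-onto-⧺ r s (x ∙ t)

reverse-onto-involutive : ∀ r s t → reverse-onto (reverse-onto r s) t ≡ reverse-onto s (r ⧺ t)
reverse-onto-involutive nil     s t = refl
reverse-onto-involutive (x ∙ r) s t = reverse-onto-involutive r (x ∙ s) t

size-reverse-onto : ∀ s t → size (reverse-onto s t) ≤ size s + size t
size-reverse-onto nil     t = n≤1+n _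
size-reverse-onto (x ∙ s) t = ≤-trans (size-reverse-onto s (x ∙ t))
  (≤-reflexive (reorder (size x) (size s) (size t)))
  where
  reorder : ∀ x s t → s + suc (x + t) ≡ suc (x + s + t)
  reorder = solve-∀

reverse-ontoᶠ : ∀ {f g} → PolyTime f → PolyTime g → PolyTime (λ t → reverse-onto (f t) (g t))
reverse-ontoᶠ F G = PolyTime-resp-≗ (λ t → same (head t) (tail t))
    -- Each round moves one cell from the list to the accumulator, so the total size is constant.
    (iterᶠ (headᶠ (headᶠ idᶠ) ∙ᶠ tailᶠ idᶠ) (λ xs c → size xs + size c) (X ⊕ X)
      (λ _ _ → m≤n+m _ _)
      (λ x xs c → ≤-reflexive (reorder (size x) (size xs) (size c)))
      (λ t → +-mono-≤ (size-head t) (size-tail t)))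
  ∘ᶠ (F ∙ᶠ G)
  where
  same : ∀ xs c → iter (λ t → head (head t) ∙ tail t) xs c ≡ reverse-onto xs c
  same nil      c = refl
  same (x ∙ xs) c = same xs (x ∙ c)
  reorder : ∀ x s t → s + suc (x + t) ≡ suc (x + s + t)
  reorder = solve-∀

-- A loop can only push onto the front of its accumulator, so appending takes two reversals.
⧺ᶠ : ∀ {f g} → PolyTime f → PolyTime g → PolyTime (λ t → f t ⧺ g t)
⧺ᶠ {f} {g} F G = PolyTime-resp-≗ (λ t → reverse-onto-involutive (f t) nil (g t))
  (reverse-ontoᶠ (reverse-ontoᶠ F nilᶠ) G)

-- h receives suffixes instead of elements because the length of a suffix
-- identifies its position.
flat : (Tree → Tree) → Tree → Tree → Tree
flat h e nil      = nil
flat h e (x ∙ xs) = h (e ∙ (x ∙ xs)) ⧺ flat h e xs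

module _ {h} (H : PolyTime h) where

  private
    -- The accumulator pairs the fixed environment with the output so far, in reverse order.
    step : Tree → Tree
    step t = head (tail t) ∙ reverse-onto (h (head (tail t) ∙ head t)) (tail (tail t))

    stepᶠ : PolyTime step
    stepᶠ = headᶠ (tailᶠ idᶠ) ∙ᶠ
      reverse-ontoᶠ (H ∘ᶠ (headᶠ (tailᶠ idᶠ) ∙ᶠ headᶠ idᶠ)) (tailᶠ (tailᶠ idᶠ))

    B : ℕ → ℕ
    B n = ⟦ sizeBound H ⟧ n

    -- The size reached so far plus a budget for the rest: `size xs` bounds the rounds left, and
    -- each adds at most `B` of the largest argument that `h` can still receive.
    Φ : Tree → Tree → ℕ
    Φ xs c = suc (size (head c) + size (tail c)) + size xs * B (suc (size (head c) + size xs))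

    dominates : ∀ xs c → size c ≤ Φ xs c
    dominates xs nil     = s≤s z≤n
    dominates xs (_ ∙ _) = m≤m+n _ _

    decreases : ∀ x xs c → Φ xs (step ((x ∙ xs) ∙ c)) ≤ Φ (x ∙ xs) c
    decreases x xs c = begin
      suc (e + size (reverse-onto (h (head c ∙ (x ∙ xs))) (tail c))) + size xs * B (suc (e + size xs))
        ≤⟨ +-mono-≤ (s≤s (+-monoʳ-≤ e (≤-trans (size-reverse-onto _ (tail c))
             (+-monoˡ-≤ o (small H _)))))
             (*-monoʳ-≤ (size xs) (⟦ sizeBound H ⟧-mono (s≤s (+-monoʳ-≤ e (size-tail (x ∙ xs)))))) ⟩
      suc (e + (b + o)) + size xs * b
        ≡⟨ reorder e b o (size xs * b) ⟩
      suc (e + o) + (b + size xs * b)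
        ≤⟨ +-monoʳ-≤ (suc (e + o)) (*-monoˡ-≤ b (s≤s (m≤n+m (size xs) (size x)))) ⟩
      suc (e + o) + size (x ∙ xs) * b ∎
      where
      open ≤-Reasoning
      e = size (head c)
      o = size (tail c)
      b = B (suc (e + size (x ∙ xs)))
      reorder : ∀ e b o c → suc (e + (b + o)) + c ≡ suc (e + o) + (b + c)
      reorder = solve-∀

    bound : Polynomial
    bound = (const 1 ⊕ (X ⊕ X)) ⊕ (X ⊗ (sizeBound H ⊚ (const 1 ⊕ (X ⊕ X))))

    bounded : ∀ t → Φ (head t) (tail t) ≤ ⟦ bound ⟧ (size t)
    bounded t = +-mono-≤
      (s≤s (+-mono-≤ (≤-trans (size-head (tail t)) (size-tail t))
                     (≤-trans (size-tail (tail t)) (size-tail t))))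
      (*-mono-≤ (size-head t) (⊚-bound (sizeBound H) (const 1 ⊕ (X ⊕ X))
        (s≤s (+-mono-≤ (≤-trans (size-head (tail t)) (size-tail t)) (size-head t)))))

    loopᶠ = iterᶠ stepᶠ Φ bound dominates decreases bounded

    same : ∀ xs e o → tail (iter step xs (e ∙ o)) ≡ reverse-onto (flat h e xs) o
    same nil      e o = refl
    same (x ∙ xs) e o = trans (same xs e (reverse-onto (h (e ∙ (x ∙ xs))) o))
      (sym (reverse-onto-⧺ (h (e ∙ (x ∙ xs))) (flat h e xs) o))

  flatᶠ : ∀ {f g} → PolyTime f → PolyTime g → PolyTime (λ t → flat h (f t) (g t))
  flatᶠ {f} {g} F G = PolyTime-resp-≗
    (λ t → trans (cong (λ r → reverse-onto r nil) (same (g t) (f t) nil))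
      (trans (reverse-onto-involutive (flat h (f t) (g t)) nil nil) (⧺-identityʳ _)))
    (reverse-ontoᶠ (tailᶠ (loopᶠ ∘ᶠ (G ∙ᶠ F ∙ᶠ nilᶠ))) nilᶠ)

-- Postprocessing the outputs of a program

outputs-steps : ∀ n {τ} → outputs (steps n ++ τ) ≡ outputs τ
outputs-steps zero    = refl
outputs-steps (suc n) = outputs-steps n

-- Steps can be saved because f t may be smaller than t.
data Postprocessed (f : Tree → Tree) (d : ℕ) : Trace → Trace → Set where
  []   : Postprocessed f d [] []
  tick : ∀ {τ τ′} → Postprocessed f d τ τ′ → Postprocessed f d (nothing ∷ τ) (nothing ∷ τ′)
  save : ∀ {τ τ′} → Postprocessed f d τ τ′ → Postprocessed f d (nothing ∷ τ) τ′
  emit : ∀ {τ τ′ n t} → n ≤ d → Postprocessed f d τ τ′ →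
         Postprocessed f d (just t ∷ τ) (steps n ++ just (f t) ∷ τ′)

module _ {f : Tree → Tree} {d : ℕ} where

  Postprocessed-steps : ∀ n → Postprocessed f d (steps n) (steps n)
  Postprocessed-steps zero    = []
  Postprocessed-steps (suc n) = tick (Postprocessed-steps n)

  -- The `m` original steps are kept or saved; only the excess of `n` over them, at most `d`, is
  -- charged to `emit`.
  Postprocessed-output : ∀ m n {t} → n ≤ m + d →
    Postprocessed f d (steps m ++ just t ∷ []) (steps n ++ just (f t) ∷ [])
  Postprocessed-output zero    n       n≤  = emit n≤ []
  Postprocessed-output (suc m) zero    n≤  = save (Postprocessed-output m zero z≤n)
  Postprocessed-output (suc m) (suc n) n≤  = tick (Postprocessed-output m n (≤-pred n≤))

  Postprocessed-++ : ∀ {τ₁ τ₁′ τ₂ τ₂′} → Postprocessed f d τ₁ τ₁′ → Postprocessed f d τ₂ τ₂′ →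
    Postprocessed f d (τ₁ ++ τ₂) (τ₁′ ++ τ₂′)
  Postprocessed-++ []               Q = Q
  Postprocessed-++ (tick P)         Q = tick (Postprocessed-++ P Q)
  Postprocessed-++ (save P)         Q = save (Postprocessed-++ P Q)
  Postprocessed-++ (emit {n = n} n≤d P) Q =
    subst (Postprocessed f d _) (sym (++-assoc (steps n) _ _)) (emit n≤d (Postprocessed-++ P Q))

  outputs-postprocessed : ∀ {τ τ′} → Postprocessed f d τ τ′ → outputs τ′ ≡ map f (outputs τ)
  outputs-postprocessed []       = refl
  outputs-postprocessed (tick P) = outputs-postprocessed P
  outputs-postprocessed (save P) = outputs-postprocessed P
  outputs-postprocessed (emit {n = n} _ P) =
    trans (outputs-steps n) (cong (_ ∷_) (outputs-postprocessed P))

  time-postprocessed : ∀ {τ τ′} → Postprocessed f d τ τ′ → time τ′ ≤ time τ + d * length (outputs τ)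
  time-postprocessed []       = z≤n
  time-postprocessed (tick P) = s≤s (time-postprocessed P)
  time-postprocessed (save P) = m≤n⇒m≤1+n (time-postprocessed P)
  time-postprocessed (emit {τ} {τ′} {n} {t} n≤d P) = begin
    time (steps n ++ just (f t) ∷ τ′)
      ≡⟨ length-++ (steps n) ⟩
    time (steps n) + suc (time τ′)
      ≡⟨ cong (_+ suc (time τ′)) (length-replicate n) ⟩
    n + suc (time τ′)
      ≤⟨ +-mono-≤ n≤d (s≤s (time-postprocessed P)) ⟩
    d + suc (time τ + d * l)
      ≡⟨ reorder d (time τ) (d * l) ⟩
    suc (time τ) + (d + d * l)
      ≡⟨ cong (suc (time τ) +_) (*-suc d l) ⟨
    suc (time τ) + d * suc l ∎
    where
    open ≤-Reasoning
    l = length (outputs τ)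
    reorder : ∀ a b c → a + suc (b + c) ≡ suc b + (a + c)
    reorder = solve-∀

delaysAfter-steps : ∀ c n {τ} → delaysAfter c (steps n ++ τ) ≡ delaysAfter (n + c) τ
delaysAfter-steps c zero    = refl
delaysAfter-steps c (suc n) {τ} = trans (delaysAfter-steps (suc c) n)
  (cong (λ m → delaysAfter m τ) (+-suc n c))

-- Here `a` is the head start of the new counter, in the application the preparation time. Saved
-- steps only widen the slack, and each output resets both counters.
delays-postprocessed : ∀ {f d b a τ τ′ c c′} → Postprocessed f d τ τ′ → c′ ≤ c + a →
  All (_≤ b) (delaysAfter c τ) → All (_≤ b + (a + d)) (delaysAfter c′ τ′)
delays-postprocessed {d = d} {a = a} [] c′≤ (c≤b ∷ []) =
  ≤-trans c′≤ (+-mono-≤ c≤b (m≤m+n a d)) ∷ []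
delays-postprocessed (tick P) c′≤ all = delays-postprocessed P (s≤s c′≤) all
delays-postprocessed (save P) c′≤ all = delays-postprocessed P (m≤n⇒m≤1+n c′≤) all
delays-postprocessed {f} {d} {b} {a} {c = c} {c′} (emit {τ′ = τ′} {n} {t} n≤d P) c′≤ (c<b ∷ all) =
  subst (All (_≤ b + (a + d))) (sym (delaysAfter-steps c′ n)) (
    (begin
      suc (n + c′)      ≤⟨ s≤s (+-mono-≤ n≤d c′≤) ⟩
      suc (d + (c + a)) ≡⟨ reorder d c a ⟩
      suc c + (a + d)   ≤⟨ +-monoˡ-≤ (a + d) c<b ⟩
      b + (a + d)       ∎)
    ∷ delays-postprocessed P z≤n all)
  where
  open ≤-Reasoning
  reorder : ∀ d c a → suc (d + (c + a)) ≡ suc c + (a + d)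
  reorder = solve-∀

-- Strict upper bounds on the variables that occur.
exprVars : Expr → Var
exprVars (var x)    = suc x
exprVars nil        = 0
exprVars (cons e f) = exprVars e ⊔ exprVars f
exprVars (hd e)     = exprVars e
exprVars (tl e)     = exprVars e

programVars : Program → Var
programVars skip                 = 0
programVars (x ≔ e)              = suc x ⊔ exprVars e
programVars (p ⨾ q)              = programVars p ⊔ programVars q
programVars (if e then p else q) = exprVars e ⊔ (programVars p ⊔ programVars q)
programVars (while e loop p)     = exprVars e ⊔ programVars p
programVars (output e)           = exprVars e

Agree : Var → Store → Store → Set
Agree k s s′ = ∀ {x} → x < k → s′ x ≡ s x

eval-agree : ∀ {k s s′} e → exprVars e ≤ k → Agree k s s′ → eval e s′ ≡ eval e s
eval-agree (var x)    e≤k s~s′ = s~s′ e≤k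
eval-agree nil        e≤k s~s′ = refl
eval-agree (cons e f) e≤k s~s′ = cong₂ _∙_
  (eval-agree e (m⊔n≤o⇒m≤o (exprVars e) _ e≤k) s~s′)
  (eval-agree f (m⊔n≤o⇒n≤o (exprVars e) _ e≤k) s~s′)
eval-agree (hd e)     e≤k s~s′ = cong head (eval-agree e e≤k s~s′)
eval-agree (tl e)     e≤k s~s′ = cong tail (eval-agree e e≤k s~s′)

update-agree : ∀ {k s s′ x t t′} → t′ ≡ t → Agree k s s′ → Agree k (s [ x ↦ t ]) (s′ [ x ↦ t′ ])
update-agree {x = x} refl s~s′ {y} y<k with y ≟ x
... | yes _ = refl
... | no  _ = s~s′ y<k

module _ {f} (F : PolyTime f) (k : Var) where

  -- The head of variable k is a parameter of the postprocessing.
  postprocess : Program → Program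
  postprocess skip                 = skip
  postprocess (x ≔ e)              = x ≔ e
  postprocess (p ⨾ q)              = postprocess p ⨾ postprocess q
  postprocess (if e then p else q) = if e then postprocess p else postprocess q
  postprocess (while e loop p)     = while e loop postprocess p
  postprocess (output e)           =
    (1 + k ≔ cons (hd (var k)) e) ⨾ program F (1 + k) ⨾ output (var (1 + k))

  record Simulation (p : Program) (a : Tree) (d : ℕ) (τ : Trace) (s₁ s′ : Store) : Set where
    constructor simulation
    field
      {trace}       : Trace
      {final}       : Store
      run           : ⟨ postprocess p , s′ ⟩⇓⟨ trace , final ⟩
      agree         : Agree k s₁ final
      parameter     : head (final k) ≡ a
      postprocessed : Postprocessed (λ t → f (a ∙ t)) d τ trace

  -- Three steps pair the parameter with the output and one reads the result; evaluating the output
  -- expression is already paid for in the original trace.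
  postprocessTime : ℕ → ℕ
  postprocessTime n = 4 + (⟦ timeBound F ⟧ n + ⟦ sizeBound F ⟧ n)

  -- By induction on the run. Stores are compared below `k` only, since the variables from `k` on
  -- belong to the postprocessing. Its cost is bounded only for the trees that are really output.
  -- Variable `k` will hold the whole prepared pair, hence only its head is tracked.
  simulate : ∀ {p a d s s₁ s′ τ} → programVars p ≤ k → ⟨ p , s ⟩⇓⟨ τ , s₁ ⟩ →
    Agree k s s′ → head (s′ k) ≡ a → All (λ t → postprocessTime (size (a ∙ t)) ≤ d) (outputs τ) →
    Simulation p a d τ s₁ s′
  simulate p≤k skip s~s′ ≡a small = simulation skip s~s′ ≡a (tick [])
  simulate p≤k (assign {x} {e}) s~s′ ≡a small = simulation assign
    (update-agree (eval-agree e (m⊔n≤o⇒n≤o (suc x) _ p≤k) s~s′) s~s′)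
    (trans (cong head (update-other _ _ (>⇒≢ (m⊔n≤o⇒m≤o (suc x) (exprVars e) p≤k)))) ≡a)
    (Postprocessed-steps (cost e))
  simulate p≤k (seq {p} {τ = τ} {τ′} P Q) s~s′ ≡a small =
    let small₁ , small₂ = All.++⁻ (outputs τ) (subst (All _) (catMaybes-++ τ τ′) small)
        module A = Simulation (simulate (m⊔n≤o⇒m≤o (programVars p) _ p≤k) P s~s′ ≡a small₁)
        module B = Simulation (simulate (m⊔n≤o⇒n≤o (programVars p) _ p≤k) Q A.agree A.parameter small₂)
    in simulation (seq A.run B.run) B.agree B.parameter
         (Postprocessed-++ A.postprocessed B.postprocessed)
  simulate pq≤k (if-true {e} {p} {q} e≢nil P) s~s′ ≡a small =
    let ≤k = m⊔n≤o⇒n≤o (exprVars e) _ pq≤k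
        module A = Simulation (simulate (m⊔n≤o⇒m≤o (programVars p) _ ≤k) P s~s′ ≡a
                     (subst (All _) (outputs-steps (cost e)) small))
    in simulation
         (if-true (e≢nil ∘ trans (sym (eval-agree e (m⊔n≤o⇒m≤o _ _ pq≤k) s~s′))) A.run)
         A.agree A.parameter (Postprocessed-++ (Postprocessed-steps (cost e)) A.postprocessed)
  simulate pq≤k (if-false {e} {p} {q} e≡nil Q) s~s′ ≡a small =
    let ≤k = m⊔n≤o⇒n≤o (exprVars e) _ pq≤k
        module A = Simulation (simulate (m⊔n≤o⇒n≤o (programVars p) _ ≤k) Q s~s′ ≡a
                     (subst (All _) (outputs-steps (cost e)) small))
    in simulation
         (if-false (trans (eval-agree e (m⊔n≤o⇒m≤o _ _ pq≤k) s~s′) e≡nil) A.run)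
         A.agree A.parameter (Postprocessed-++ (Postprocessed-steps (cost e)) A.postprocessed)
  simulate p≤k (while-true {e} {p} {τ = τ} {τ′} e≢nil P Q) s~s′ ≡a small =
    let small₁ , small₂ = All.++⁻ (outputs τ) (subst (All _)
          (trans (outputs-steps (cost e)) (catMaybes-++ τ τ′)) small)
        module A = Simulation (simulate (m⊔n≤o⇒n≤o (exprVars e) _ p≤k) P s~s′ ≡a small₁)
        module B = Simulation (simulate p≤k Q A.agree A.parameter small₂)
    in simulation
         (while-true (e≢nil ∘ trans (sym (eval-agree e (m⊔n≤o⇒m≤o _ _ p≤k) s~s′))) A.run B.run)
         B.agree B.parameter
         (Postprocessed-++ (Postprocessed-steps (cost e))
           (Postprocessed-++ A.postprocessed B.postprocessed))
  simulate p≤k (while-false {e} e≡nil) s~s′ ≡a small = simulation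
    (while-false (trans (eval-agree e (m⊔n≤o⇒m≤o _ _ p≤k) s~s′) e≡nil))
    s~s′ ≡a (Postprocessed-steps (cost e))
  simulate {a = a} {d} {s} {s′ = s′} p≤k (output {e}) s~s′ ≡a small = simulation
    (subst (λ τ → ⟨ postprocess (output e) , s′ ⟩⇓⟨ τ , A.final ⟩) trace≡
      (seq assign (seq A.run output)))
    (λ x<k → trans (A.frame (m<n⇒m<1+n x<k)) (trans (update-below s′ _ (m<n⇒m<1+n x<k)) (s~s′ x<k)))
    (trans (cong head (trans (A.frame (n<1+n k)) (update-below s′ _ (n<1+n k)))) ≡a)
    (Postprocessed-output (cost e + size t) total total≤)
    where
    t = eval e s
    module A = Evaluates (evaluatesAt F (1 + k) (s′ [ 1 + k ↦ _ ])
      (trans (update-same s′ (1 + k) _) (cong₂ _∙_ ≡a (eval-agree e p≤k s~s′))))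
    total = (3 + cost e) + (A.duration + (1 + size (f (a ∙ t))))
    trace≡ : steps (3 + cost e) ++ steps A.duration ++ steps (1 + size (A.final (1 + k))) ++
             just (A.final (1 + k)) ∷ [] ≡ steps total ++ just (f (a ∙ t)) ∷ []
    trace≡ = begin
      steps (3 + cost e) ++ steps A.duration ++ steps (1 + size (A.final (1 + k))) ++
        just (A.final (1 + k)) ∷ []
        ≡⟨ cong (λ r → steps (3 + cost e) ++ steps A.duration ++ steps (1 + size r) ++ just r ∷ [])
             A.result ⟩
      steps (3 + cost e) ++ steps A.duration ++ steps n ++ z
        ≡⟨ cong (steps (3 + cost e) ++_) (++-assoc (steps A.duration) (steps n) z) ⟨
      steps (3 + cost e) ++ (steps A.duration ++ steps n) ++ z
        ≡⟨ cong (λ r → steps (3 + cost e) ++ r ++ z) (steps-+ A.duration) ⟩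
      steps (3 + cost e) ++ steps (A.duration + n) ++ z
        ≡⟨ ++-assoc (steps (3 + cost e)) (steps (A.duration + n)) z ⟨
      (steps (3 + cost e) ++ steps (A.duration + n)) ++ z
        ≡⟨ cong (_++ z) (steps-+ (3 + cost e)) ⟩
      steps total ++ z ∎
      where
      open ≡-Reasoning
      n = 1 + size (f (a ∙ t))
      z = just (f (a ∙ t)) ∷ []
    affordable : postprocessTime (size (a ∙ t)) ≤ d
    affordable = All.head (subst (All _) (outputs-steps (cost e + size t)) small)
    total≤ : total ≤ cost e + size t + d
    total≤ = begin
      (3 + cost e) + (A.duration + (1 + size (f (a ∙ t))))
        ≡⟨ reorder (cost e) A.duration (size (f (a ∙ t))) ⟩
      cost e + (4 + (A.duration + size (f (a ∙ t))))
        ≤⟨ +-monoʳ-≤ (cost e) (+-monoʳ-≤ 4 (+-mono-≤ A.fast (small′ (a ∙ t)))) ⟩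
      cost e + postprocessTime (size (a ∙ t))
        ≤⟨ +-mono-≤ (m≤m+n (cost e) (size t)) affordable ⟩
      cost e + size t + d ∎
      where
      open ≤-Reasoning
      small′ = PolyTime.small F
      reorder : ∀ c n r → (3 + c) + (n + (1 + r)) ≡ c + (4 + (n + r))
      reorder = solve-∀

-- Parsimonious reductions between enumeration problems

-- As every tree has positive size, an output-polynomial bound may also depend on the number of
-- outputs.
length≤sum-size : ∀ ts → length ts ≤ sum (map size ts)
length≤sum-size []       = z≤n
length≤sum-size (t ∷ ts) = +-mono-≤ (1≤size t) (length≤sum-size ts)
  where
  1≤size : ∀ t → 1 ≤ size t
  1≤size nil     = ≤-refl
  1≤size (_ ∙ _) = s≤s z≤n

sum-size≤ : ∀ {b ts} → All (λ t → size t ≤ b) ts → sum (map size ts) ≤ length ts * b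
sum-size≤ []         = z≤n
sum-size≤ (t≤ ∷ ts≤) = +-mono-≤ t≤ (sum-size≤ ts≤)

-- The 4 is one list cell plus at most three nodes for the bit.
size-encodeSubset : ∀ {n} (S : Subset n) → size (encodeSubset S) ≤ 1 + 4 * n
size-encodeSubset []                = ≤-refl
size-encodeSubset {suc n} (x ∷ S) = begin
  suc (size (encodeBool x) + size (encodeSubset S))
    ≤⟨ s≤s (+-mono-≤ (size-encodeBool x) (size-encodeSubset S)) ⟩
  suc (3 + (1 + 4 * n))
    ≡⟨ reorder n ⟩
  1 + 4 * suc n ∎
  where
  open ≤-Reasoning
  size-encodeBool : ∀ b → size (encodeBool b) ≤ 3
  size-encodeBool true  = ≤-refl
  size-encodeBool false = s≤s z≤n
  reorder : ∀ n → suc (3 + (1 + 4 * n)) ≡ 1 + 4 * suc n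
  reorder = solve-∀

-- On solutions `to` and `from` are inverse to each other, so decoding output by output yields each
-- solution exactly once. Decoding sees a single solution and not the instance; `parameter` carries
-- what it must know of the latter.
record Reduction (𝒬 𝒫 : EnumerationProblem) : Set where
  private
    module 𝒬 = EnumerationProblem 𝒬
    module 𝒫 = EnumerationProblem 𝒫
  field
    {prepare decode} : Tree → Tree
    prepareᶠ         : PolyTime prepare
    decodeᶠ          : PolyTime decode
    transform        : 𝒬.Instance → 𝒫.Instance
    parameter        : 𝒬.Instance → Tree
    prepare-encode   : ∀ I → prepare (𝒬.encode I) ≡ parameter I ∙ 𝒫.encode (transform I)
    ground≤          : ∀ I → 𝒫.ground (transform I) ≤ inputSize 𝒫 (transform I)
    to               : ∀ I → Subset (𝒫.ground (transform I)) → Subset (𝒬.ground I)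
    from             : ∀ I → Subset (𝒬.ground I) → Subset (𝒫.ground (transform I))
    decode-encode    : ∀ I C → decode (parameter I ∙ encodeSubset C) ≡ encodeSubset (to I C)
    to-solution      : ∀ I {C} → 𝒫.IsSolution (transform I) C → 𝒬.IsSolution I (to I C)
    from-solution    : ∀ I {S} → 𝒬.IsSolution I S → 𝒫.IsSolution (transform I) (from I S)
    to-from          : ∀ I S → to I (from I S) ≡ S
    from-to          : ∀ I {C} → 𝒫.IsSolution (transform I) C → from I (to I C) ≡ C

module _ {𝒬 𝒫} (R : Reduction 𝒬 𝒫) where
  open Reduction R
  private
    module 𝒬 = EnumerationProblem 𝒬
    module 𝒫 = EnumerationProblem 𝒫

  private
    -- All in the size of the original instance: `Q` bounds the prepared pair, `B` an encoded
    -- solution of the new instance, and `D` the postprocessing of one output.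
    Q B D : Polynomial
    Q = sizeBound prepareᶠ
    B = const 1 ⊕ (const 4 ⊗ Q)
    D = (const 4 ⊕ (timeBound decodeᶠ ⊕ sizeBound decodeᶠ)) ⊚ (const 1 ⊕ (Q ⊕ B))

    T : Polynomial
    -- One step copies the input to `k`, two move the new instance to variable 0.
    T = const 3 ⊕ timeBound prepareᶠ

    ≤Q : ∀ I → size (parameter I ∙ 𝒫.encode (transform I)) ≤ ⟦ Q ⟧ (inputSize 𝒬 I)
    ≤Q I = ≤-trans (≤-reflexive (cong size (sym (prepare-encode I)))) (small prepareᶠ _)

    parameter≤ : ∀ I → size (parameter I) ≤ ⟦ Q ⟧ (inputSize 𝒬 I)
    parameter≤ I = ≤-trans (size-head (parameter I ∙ 𝒫.encode (transform I))) (≤Q I)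

    instance≤ : ∀ I → inputSize 𝒫 (transform I) ≤ ⟦ Q ⟧ (inputSize 𝒬 I)
    instance≤ I = ≤-trans (size-tail (parameter I ∙ 𝒫.encode (transform I))) (≤Q I)

    encodeSubset≤ : ∀ I C → size (encodeSubset {𝒫.ground (transform I)} C) ≤ ⟦ B ⟧ (inputSize 𝒬 I)
    encodeSubset≤ I C = ≤-trans (size-encodeSubset C)
      (s≤s (*-monoʳ-≤ 4 (≤-trans (ground≤ I) (instance≤ I))))

  reduced : Program → Program
  reduced p = (k ≔ var 0) ⨾ program prepareᶠ k ⨾ (0 ≔ tl (var k)) ⨾ postprocess decodeᶠ k p
    -- The successor keeps `k` apart from the input variable 0 even if no variable occurs in `p`.
    where k = suc (programVars p)

  record ReducedRun (p : Program) (I : 𝒬.Instance) (τ : Trace) : Set where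
    field
      preparation   : ℕ
      trace         : Trace
      run           : Run (reduced p) (𝒬.encode I) (steps preparation ++ trace)
      postprocessed : Postprocessed (λ t → decode (parameter I ∙ t)) (⟦ D ⟧ (inputSize 𝒬 I)) τ trace
      preparation≤  : preparation ≤ ⟦ T ⟧ (inputSize 𝒬 I)

  outputs≤ : ∀ I {τ} → Enumerates 𝒫 (transform I) τ →
    All (λ t → size t ≤ ⟦ B ⟧ (inputSize 𝒬 I)) (outputs τ)
  outputs≤ I {τ} (Ss , out≡ , _) = subst (All _) (sym out≡)
    (All.map⁺ (All.universal (encodeSubset≤ I) Ss))

  run-reduced : ∀ {p τ} I → Run p (𝒫.encode (transform I)) τ → Enumerates 𝒫 (transform I) τ →
    ReducedRun p I τ
  run-reduced {p} {τ} I (_ , P) enum = record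
    { preparation   = 1 + (A.duration + 2)
    ; trace         = C.trace
    ; run           = C.final , subst (λ τ′ → ⟨ reduced p , s ⟩⇓⟨ τ′ , C.final ⟩) trace≡
                        (seq assign (seq A.run (seq assign C.run)))
    ; postprocessed = C.postprocessed
    ; preparation≤  = ≤-trans (≤-reflexive (cong suc (+-comm A.duration 2))) (+-monoʳ-≤ 3 A.fast)
    }
    where
    k = suc (programVars p)
    s = initial (𝒬.encode I)
    module A = Evaluates (evaluatesAt prepareᶠ k (s [ k ↦ 𝒬.encode I ]) (update-same s k _))
    prepared : A.final k ≡ parameter I ∙ 𝒫.encode (transform I)
    prepared = trans A.result (prepare-encode I)
    s₁ = A.final [ 0 ↦ tail (A.final k) ]
    agree : Agree k (initial (𝒫.encode (transform I))) s₁
    agree {zero}  _   = cong tail prepared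
    -- The preparation works from `k` upwards, so the other variables of `p` are still `nil`.
    agree {suc x} x<k = trans (A.frame x<k) (update-below s (𝒬.encode I) x<k)
    affordable : All (λ t → postprocessTime decodeᶠ k (size (parameter I ∙ t)) ≤ ⟦ D ⟧ (inputSize 𝒬 I))
      (outputs τ)
    affordable = All.map (λ t≤ → ⊚-bound (const 4 ⊕ (timeBound decodeᶠ ⊕ sizeBound decodeᶠ))
      (const 1 ⊕ (Q ⊕ B)) (s≤s (+-mono-≤ (parameter≤ I) t≤))) (outputs≤ I {τ} enum)
    module C = Simulation (simulate decodeᶠ k (n≤1+n _) P agree
      (cong head prepared) affordable)
    trace≡ : steps 1 ++ steps A.duration ++ steps 2 ++ C.trace ≡
             steps (1 + (A.duration + 2)) ++ C.trace
    trace≡ = cong (nothing ∷_) (trans (sym (++-assoc (steps A.duration) (steps 2) C.trace))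
      (cong (_++ C.trace) (steps-+ A.duration)))

  enumerates-reduced : ∀ {p τ} I (r : ReducedRun p I τ) → Enumerates 𝒫 (transform I) τ →
    Enumerates 𝒬 I (steps (ReducedRun.preparation r) ++ ReducedRun.trace r)
  enumerates-reduced {τ = τ} I r (Cs , out≡ , unique , solutions) =
    -- The decoded list is duplicate-free because `from` maps it back to the duplicate-free list
    -- `Cs`.
    map (to I) Cs , outputs≡ , Unique.map⁻ {f = from I} (subst Unique (sym (inverse Cs id)) unique) ,
    λ S → mk⇔
      (λ S∈ → let C , C∈ , S≡ = ∈-map⁻ (to I) S∈ in
        subst (𝒬.IsSolution I) (sym S≡) (to-solution I (Equivalence.to (solutions C) C∈)))
      (λ sol → subst (List._∈ map (to I) Cs) (to-from I S)
        (∈-map⁺ (to I) (Equivalence.from (solutions (from I S)) (from-solution I sol))))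
    where
    open ReducedRun r
    open ≡-Reasoning
    outputs≡ : outputs (steps preparation ++ trace) ≡ map encodeSubset (map (to I) Cs)
    outputs≡ = begin
      outputs (steps preparation ++ trace)                    ≡⟨ outputs-steps preparation ⟩
      outputs trace                                           ≡⟨ outputs-postprocessed postprocessed ⟩
      map (λ t → decode (parameter I ∙ t)) (outputs τ)        ≡⟨ cong (map _) out≡ ⟩
      map (λ t → decode (parameter I ∙ t)) (map encodeSubset Cs) ≡⟨ map-∘ Cs ⟨
      map (λ C → decode (parameter I ∙ encodeSubset C)) Cs    ≡⟨ map-cong (decode-encode I) Cs ⟩
      map (encodeSubset ∘ to I) Cs                            ≡⟨ map-∘ Cs ⟩
      map encodeSubset (map (to I) Cs)                        ∎
    -- The induction runs over parts of `Cs`, as `from-to` holds for solutions only.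
    inverse : ∀ Ds → (∀ {C} → C List.∈ Ds → C List.∈ Cs) → map (from I) (map (to I) Ds) ≡ Ds
    inverse []       _    = refl
    inverse (C ∷ Ds) incl = cong₂ _∷_
      (from-to I (Equivalence.to (solutions C) (incl (here refl)))) (inverse Ds (incl ∘ there))

  -- The given algorithm is bounded in terms of its own outputs, which may be larger than the
  -- decoded ones. But both are equally many, and each original output has size at most `B`.
  output-polynomial : HasOutputPolynomialAlgorithm 𝒫 → HasOutputPolynomialAlgorithm 𝒬
  output-polynomial (p , f , algorithm) =
    reduced p , T ⊕ ((f ⊚ (Q ⊕ (X ⊗ B))) ⊕ (D ⊗ X)) , λ I →
      let τ , P , enum , fast = algorithm (transform I)
          r = run-reduced I P enum
      in _ , ReducedRun.run r , enumerates-reduced I r enum , bound I τ r enum fast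
    where
    bound : ∀ I τ (r : ReducedRun p I τ) → Enumerates 𝒫 (transform I) τ →
      time τ ≤ ⟦ f ⟧ (inputSize 𝒫 (transform I) + outputSize τ) →
      time (steps (ReducedRun.preparation r) ++ ReducedRun.trace r) ≤ _
    bound I τ r enum fast = begin
      time (steps preparation ++ trace)
        ≡⟨ length-++ (steps preparation) ⟩
      time (steps preparation) + time trace
        ≡⟨ cong (_+ time trace) (length-replicate preparation) ⟩
      preparation + time trace
        ≤⟨ +-mono-≤ (≤-trans preparation≤ (⟦ T ⟧-mono m≤N))
             (≤-trans (time-postprocessed postprocessed)
               (+-mono-≤ time≤ (*-mono-≤ (⟦ D ⟧-mono m≤N) count≤N))) ⟩
      _ ∎
      where
      open ≤-Reasoning
      open ReducedRun r
      m = inputSize 𝒬 I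
      total = steps preparation ++ trace
      N = m + outputSize total
      m≤N : m ≤ N
      m≤N = m≤m+n m _
      count≤N : length (outputs τ) ≤ N
      count≤N = begin
        length (outputs τ)             ≡⟨ length-map _ (outputs τ) ⟨
        length (map _ (outputs τ))     ≡⟨ cong length (outputs-postprocessed postprocessed) ⟨
        length (outputs trace)         ≡⟨ cong length (outputs-steps preparation) ⟨
        length (outputs total)         ≤⟨ length≤sum-size (outputs total) ⟩
        outputSize total               ≤⟨ m≤n+m _ m ⟩
        N                              ∎
      time≤ : time τ ≤ ⟦ f ⊚ (Q ⊕ (X ⊗ B)) ⟧ N
      time≤ = ≤-trans fast (⊚-bound f (Q ⊕ (X ⊗ B)) (+-mono-≤
        (≤-trans (instance≤ I) (⟦ Q ⟧-mono m≤N))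
        (≤-trans (sum-size≤ (outputs≤ I {τ} enum)) (*-mono-≤ count≤N (⟦ B ⟧-mono m≤N)))))

  polynomial-delay : HasPolynomialDelayAlgorithm 𝒫 → HasPolynomialDelayAlgorithm 𝒬
  polynomial-delay (p , f , algorithm) =
    reduced p , (f ⊚ Q) ⊕ (T ⊕ D) , λ I →
      let τ , P , enum , fast = algorithm (transform I)
          r = run-reduced I P enum
          open ReducedRun r
      in _ , run , enumerates-reduced I r enum ,
         subst (All _) (sym (delaysAfter-steps 0 preparation))
           (delays-postprocessed postprocessed
             (≤-trans (≤-reflexive (+-identityʳ preparation)) preparation≤)
             (All.map (λ d≤ → ≤-trans d≤ (⊚-bound f Q (instance≤ I))) fast))

-- The graph of an incidence matrix

does-true : ∀ {P : Set} (P? : Dec P) → P → does P? ≡ true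
does-true (yes _) p = refl
does-true (no ¬p) p = contradiction p ¬p

true-does : ∀ {P : Set} (P? : Dec P) → does P? ≡ true → P
true-does (yes p) _ = p

∈-tabulate⁺ : ∀ {n} {f : Fin n → Bool} {i} → f i ≡ true → i ∈ tabulate f
∈-tabulate⁺ {f = f} {i} eq = lookup⇒[]= i _ (trans (lookup∘tabulate f i) eq)

∈-tabulate⁻ : ∀ {n} {f : Fin n → Bool} {i} → i ∈ tabulate f → f i ≡ true
∈-tabulate⁻ {f = f} {i} i∈ = trans (sym (lookup∘tabulate f i)) ([]=⇒lookup i∈)

∣p∪q∣≤∣p∣+∣q∣ : ∀ {n} (p q : Subset n) → ∣ p ∪ q ∣ ≤ ∣ p ∣ + ∣ q ∣
∣p∪q∣≤∣p∣+∣q∣ []            []            = z≤n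
∣p∪q∣≤∣p∣+∣q∣ (inside ∷ p)  (inside ∷ q)  =
  s≤s (≤-trans (∣p∪q∣≤∣p∣+∣q∣ p q) (+-monoʳ-≤ ∣ p ∣ (n≤1+n _)))
∣p∪q∣≤∣p∣+∣q∣ (inside ∷ p)  (outside ∷ q) = s≤s (∣p∪q∣≤∣p∣+∣q∣ p q)
∣p∪q∣≤∣p∣+∣q∣ (outside ∷ p) (inside ∷ q)  =
  ≤-trans (s≤s (∣p∪q∣≤∣p∣+∣q∣ p q)) (≤-reflexive (sym (+-suc ∣ p ∣ ∣ q ∣)))
∣p∪q∣≤∣p∣+∣q∣ (outside ∷ p) (outside ∷ q) = ∣p∪q∣≤∣p∣+∣q∣ p q

∣p∣≤2 : ∀ {n} {p : Subset n} a b → (∀ {i} → i ∈ p → i ≡ a ⊎ i ≡ b) → ∣ p ∣ ≤ 2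
∣p∣≤2 {p = p} a b among = begin
  ∣ p ∣                   ≤⟨ p⊆q⇒∣p∣≤∣q∣ p⊆ ⟩
  ∣ ⁅ a ⁆ ∪ ⁅ b ⁆ ∣       ≤⟨ ∣p∪q∣≤∣p∣+∣q∣ ⁅ a ⁆ ⁅ b ⁆ ⟩
  ∣ ⁅ a ⁆ ∣ + ∣ ⁅ b ⁆ ∣   ≡⟨ cong₂ _+_ (∣⁅x⁆∣≡1 a) (∣⁅x⁆∣≡1 b) ⟩
  2                       ∎
  where
  open ≤-Reasoning
  p⊆ : p ⊆ ⁅ a ⁆ ∪ ⁅ b ⁆
  p⊆ i∈p with among i∈p
  ... | inj₁ refl = x∈p∪q⁺ (inj₁ (x∈⁅x⁆ a))
  ... | inj₂ refl = x∈p∪q⁺ (inj₂ (x∈⁅x⁆ b))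

AllPairs-lookup : ∀ {A : Set} {R : A → A → Set} {xs} → AllPairs R xs →
  ∀ {i j} → i Fin.< j → R (List.lookup xs i) (List.lookup xs j)
AllPairs-lookup (px ∷ _)  {zero}  {suc j} _   = All.lookup px (∈-lookup j)
AllPairs-lookup (_ ∷ pxs) {suc i} {suc j} i<j = AllPairs-lookup pxs (s<s⁻¹ i<j)

-- Row 0 stands for an additional hyperedge containing all n elements, and the
-- columns 0 and 1 for two additional elements that lie in no hyperedge.
data Vertex (m n : ℕ) : Set where
  pendant middle : Fin (suc m) → Fin (2 + n) → Vertex m n
  star           : Fin (suc m) → Vertex m n
  element        : Fin n → Vertex m n

rank : ∀ {m n} → Vertex m n → ℕ
rank (pendant _ _) = 0
rank (middle _ _)  = 1
rank (star _)      = 2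
rank (element _)   = 3

-- The graph argument uses only these properties of the vertex order; the concrete list matters for
-- the encodings alone.
record Numbering (m n : ℕ) : Set where
  field
    order          : ℕ
    vertexAt       : Fin order → Vertex m n
    index          : Vertex m n → Fin order
    vertexAt-index : ∀ v → vertexAt (index v) ≡ v
    index-vertexAt : ∀ i → index (vertexAt i) ≡ i
    rank-mono      : ∀ {i j} → i Fin.≤ j → rank (vertexAt i) ≤ rank (vertexAt j)

module _ (m n : ℕ) where

  pendants middles stars elements others vertices : List (Vertex m n)
  pendants = cartesianProductWith pendant (allFin (suc m)) (allFin (2 + n))
  middles  = cartesianProductWith middle (allFin (suc m)) (allFin (2 + n))
  stars    = map star (allFin (suc m))
  elements = map element (allFin n)
  others   = pendants ++ middles ++ stars
  vertices = others ++ elements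

  ∈-vertices : ∀ v → v List.∈ vertices
  ∈-vertices (pendant e w) = ∈-++⁺ˡ (∈-++⁺ˡ
    (∈-cartesianProductWith⁺ pendant (∈-allFin e) (∈-allFin w)))
  ∈-vertices (middle e w)  = ∈-++⁺ˡ (∈-++⁺ʳ pendants (∈-++⁺ˡ
    (∈-cartesianProductWith⁺ middle (∈-allFin e) (∈-allFin w))))
  ∈-vertices (star e)      = ∈-++⁺ˡ (∈-++⁺ʳ pendants (∈-++⁺ʳ middles (∈-map⁺ star (∈-allFin e))))
  ∈-vertices (element v)   = ∈-++⁺ʳ others (∈-map⁺ element (∈-allFin v))

  private
    -- Holding pairwise along the list, this gives both the injectivity of `vertexAt` and the
    -- monotonicity of the rank.
    Before : Vertex m n → Vertex m n → Set
    Before u v = u ≢ v × rank u ≤ rank v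

    Rank : ℕ → List (Vertex m n) → Set
    Rank r = All (λ v → rank v ≡ r)

    block : ∀ {r vs} → Unique vs → Rank r vs → AllPairs Before vs
    block []           []       = []
    block (u∉vs ∷ vs!) (eq ∷ rs) =
      All.zipWith (λ (u≢v , eq′) → u≢v , ≤-reflexive (trans eq (sym eq′))) (u∉vs , rs) ∷ block vs! rs

    append : ∀ {r us vs} → AllPairs Before us → All (λ u → rank u < r) us →
      Rank r vs → AllPairs Before vs → AllPairs Before (us ++ vs)
    append us! us< vs≡ vs! = AllPairs.++⁺ us! vs!
      (All.map (λ u<r → All.map (λ {v} v≡r →
          (λ u≡v → <⇒≢ (<-≤-trans u<r (≤-reflexive (sym v≡r))) (cong rank u≡v)) ,
          <⇒≤ (<-≤-trans u<r (≤-reflexive (sym v≡r)))) vs≡)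
        us<)

    rank-product : ∀ {A B : Set} {r} (f : A → B → Vertex m n) → (∀ a b → rank (f a b) ≡ r) →
      ∀ as bs → Rank r (cartesianProductWith f as bs)
    rank-product f eq []       bs = []
    rank-product f eq (a ∷ as) bs = All.++⁺
      (All.map⁺ (All.universal (eq a) bs)) (rank-product f eq as bs)

    lower : ∀ {r s vs} → r < s → Rank r vs → All (λ v → rank v < s) vs
    lower r<s = All.map (λ eq → ≤-<-trans (≤-reflexive eq) r<s)

    pendants≡ : Rank 0 pendants
    pendants≡ = rank-product pendant (λ _ _ → refl) (allFin (suc m)) (allFin (2 + n))

    middles≡ : Rank 1 middles
    middles≡ = rank-product middle (λ _ _ → refl) (allFin (suc m)) (allFin (2 + n))

    stars≡ : Rank 2 stars
    stars≡ = All.map⁺ (All.universal (λ _ → refl) _)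

    elements≡ : Rank 3 elements
    elements≡ = All.map⁺ (All.universal (λ _ → refl) _)

    sorted : AllPairs Before vertices
    sorted = append
      (subst (AllPairs Before) (++-assoc pendants middles stars)
        (append
          (append
            (block (Unique.cartesianProductWith⁺ pendant (λ { refl → refl , refl })
              (Unique.allFin⁺ _) (Unique.allFin⁺ _)) pendants≡)
            (lower (n<1+n 0) pendants≡) middles≡
            (block (Unique.cartesianProductWith⁺ middle (λ { refl → refl , refl })
              (Unique.allFin⁺ _) (Unique.allFin⁺ _)) middles≡))
          (All.++⁺ (lower (s≤s z≤n) pendants≡) (lower (n<1+n 1) middles≡)) stars≡
          (block (Unique.map⁺ (λ { refl → refl }) (Unique.allFin⁺ _)) stars≡)))
      (All.++⁺ (lower (s≤s z≤n) pendants≡)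
        (All.++⁺ (lower (s≤s (s≤s z≤n)) middles≡) (lower (n<1+n 2) stars≡)))
      elements≡
      (block (Unique.map⁺ (λ { refl → refl }) (Unique.allFin⁺ _)) elements≡)

  numbering : Numbering m n
  numbering = record
    { order          = length vertices
    ; vertexAt       = at
    ; index          = ix
    ; vertexAt-index = at-ix
    ; index-vertexAt = ix-at
    ; rank-mono      = mono
    }
    where
    at : Fin (length vertices) → Vertex m n
    at = List.lookup vertices

    ix : Vertex m n → Fin (length vertices)
    ix v = Any.index (∈-vertices v)

    at-ix : ∀ v → at (ix v) ≡ v
    at-ix v = sym (lookup-index (∈-vertices v))

    ix-at : ∀ i → ix (at i) ≡ i
    ix-at i with Fin.<-cmp (ix (at i)) i
    ... | tri< lt _ _ = contradiction (at-ix (at i)) (proj₁ (AllPairs-lookup sorted lt))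
    ... | tri≈ _ eq _ = eq
    ... | tri> _ _ gt = contradiction (sym (at-ix (at i))) (proj₁ (AllPairs-lookup sorted gt))

    mono : ∀ {i j} → i Fin.≤ j → rank (at i) ≤ rank (at j)
    mono {i} {j} i≤j with Fin.<-cmp i j
    ... | tri< lt _ _ = proj₂ (AllPairs-lookup sorted lt)
    ... | tri≈ _ eq _ = ≤-reflexive (cong (rank ∘ at) eq)
    ... | tri> _ _ gt = contradiction i≤j (<⇒≱ gt)

module Construction {m n : ℕ} (numbers : Numbering m n)
  (incident : Fin (suc m) → Fin n → Bool) (full : ∀ v → incident zero v ≡ true) where

  open Numbering numbers renaming (order to N; vertexAt to at; index to ix)

  -- Every edge is oriented away from its middle end. Hence middle vertices against all others are a
  -- bipartition, and the middle vertices alone cover all edges.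
  data Edge : Vertex m n → Vertex m n → Set where
    to-pendant : ∀ {e w} → Edge (middle e w) (pendant e w)
    to-star    : ∀ {e w} → Edge (middle e w) (star e)
    to-element : ∀ {e v} → incident e v ≡ true → Edge (middle e (suc (suc v))) (element v)

  isEdge : Vertex m n → Vertex m n → Bool
  isEdge (middle e w) (pendant e′ w′) = does (e Fin.≟ e′) ∧ does (w Fin.≟ w′)
  isEdge (middle e w) (middle e′ w′)  = false
  isEdge (middle e w) (star e′)       = does (e Fin.≟ e′)
  isEdge (middle e w) (element v)     = does (w Fin.≟ suc (suc v)) ∧ incident e v
  isEdge (pendant _ _) _ = false
  isEdge (star _)      _ = false
  isEdge (element _)   _ = false

  joined : Vertex m n → Vertex m n → Bool
  joined u v = isEdge u v ∨ isEdge v u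

  Joined : Vertex m n → Vertex m n → Set
  Joined u v = Edge u v ⊎ Edge v u

  private
    ∧-true : ∀ {a b} → a ∧ b ≡ true → a ≡ true × b ≡ true
    ∧-true {true} eq = refl , eq

  isEdge-sound : ∀ u v → isEdge u v ≡ true → Edge u v
  isEdge-sound (middle e w) (pendant e′ w′) eq with ∧-true eq
  ... | p , q with true-does (e Fin.≟ e′) p | true-does (w Fin.≟ w′) q
  ... | refl | refl = to-pendant
  isEdge-sound (middle e w) (star e′) eq with true-does (e Fin.≟ e′) eq
  ... | refl = to-star
  isEdge-sound (middle e w) (element v) eq with ∧-true eq
  ... | p , q with true-does (w Fin.≟ suc (suc v)) p
  ... | refl = to-element q

  isEdge-complete : ∀ {u v} → Edge u v → isEdge u v ≡ true
  isEdge-complete (to-pendant {e} {w}) =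
    cong₂ _∧_ (does-true (e Fin.≟ e) refl) (does-true (w Fin.≟ w) refl)
  isEdge-complete (to-star {e})        = does-true (e Fin.≟ e) refl
  isEdge-complete (to-element {e} {v} inc) =
    cong₂ _∧_ (does-true (suc (suc v) Fin.≟ suc (suc v)) refl) inc

  joined-sound : ∀ u v → joined u v ≡ true → Joined u v
  joined-sound u v eq with isEdge u v in uv
  ... | true  = inj₁ (isEdge-sound u v uv)
  ... | false = inj₂ (isEdge-sound v u eq)

  joined-complete : ∀ {u v} → Joined u v → joined u v ≡ true
  joined-complete {u} {v} (inj₁ uv) rewrite isEdge-complete uv = refl
  joined-complete {u} {v} (inj₂ vu) rewrite isEdge-complete vu = ∨-comm (isEdge u v) true

  adjacency : Fin N → Subset N
  adjacency i = tabulate λ j → joined (at i) (at j)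

  adjacent⁻ : ∀ {i j} → j ∈ adjacency i → Joined (at i) (at j)
  adjacent⁻ {i} {j} = joined-sound (at i) (at j) ∘ ∈-tabulate⁻

  adjacent⁺ : ∀ {i j} → Joined (at i) (at j) → j ∈ adjacency i
  adjacent⁺ {i} ij = ∈-tabulate⁺ {f = λ j → joined (at i) (at j)} (joined-complete ij)

  irreflexive : ∀ {u} → ¬ Joined u u
  irreflexive (inj₁ ())
  irreflexive (inj₂ ())

  graph : Graph
  graph = record
    { order      = N
    ; neighbours = adjacency
    ; symmetric  = adjacent⁺ ∘ swap ∘ adjacent⁻
    ; loopless   = λ i → irreflexive ∘ adjacent⁻
    }

  isMiddle : Vertex m n → Bool
  isMiddle (middle _ _) = true
  isMiddle _            = false

  edge-crosses : ∀ {u v} → Joined u v → isMiddle u ≢ isMiddle v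
  edge-crosses (inj₁ to-pendant)     ()
  edge-crosses (inj₁ to-star)        ()
  edge-crosses (inj₁ (to-element _)) ()
  edge-crosses (inj₂ to-pendant)     ()
  edge-crosses (inj₂ to-star)        ()
  edge-crosses (inj₂ (to-element _)) ()

  bipartite : IsBipartite graph
  bipartite = isMiddle ∘ at , edge-crosses ∘ adjacent⁻

  -- Only a middle vertex with a proper column can have two later neighbours, its star and the
  -- element of its column. Where there are fewer, a witness is repeated, and where there is none,
  -- the vertex itself fills the places.
  few-later-neighbours : ∀ u → ∃[ a ] ∃[ b ]
    (∀ {v} → Joined u v → rank u ≤ rank v → v ≡ a ⊎ v ≡ b)
  few-later-neighbours (pendant e w) = middle e w , middle e w , λ { (inj₂ to-pendant) _ → inj₁ refl }
  few-later-neighbours (middle e zero) = star e , star e , λ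
    { (inj₁ to-star) _ → inj₁ refl ; (inj₁ to-pendant) () }
  few-later-neighbours (middle e (suc zero)) = star e , star e , λ
    { (inj₁ to-star) _ → inj₁ refl ; (inj₁ to-pendant) () }
  few-later-neighbours (middle e (suc (suc v))) = star e , element v , λ
    { (inj₁ to-star) _ → inj₁ refl ; (inj₁ (to-element _)) _ → inj₂ refl ; (inj₁ to-pendant) () }
  few-later-neighbours (star e) = star e , star e , λ { (inj₂ to-star) (s≤s ()) }
  few-later-neighbours (element v) = element v , element v , λ { (inj₂ (to-element _)) (s≤s ()) }

  two-degenerate : IsDegenerate graph 2
  two-degenerate = Permutation.id , λ i →
    let a , b , among = few-later-neighbours (at i) in
    ∣p∣≤2 (ix a) (ix b) λ {j} j∈ →
      let j∈N , later = x∈p∩q⁻ (adjacency i) _ j∈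
          i≤j = true-does (i Fin.≤? j) (∈-tabulate⁻ later)
      in Sum.map (λ eq → trans (sym (index-vertexAt j)) (cong ix eq))
                 (λ eq → trans (sym (index-vertexAt j)) (cong ix eq))
           (among (adjacent⁻ j∈N) (rank-mono i≤j))

  -- Connected vertex covers and hitting sets

  -- Row zero is left out: it is no hyperedge, and the empty set has to qualify when there are no
  -- hyperedges.
  Hits : Subset n → Set
  Hits S = ∀ e → ∃[ v ] (v ∈ S × incident (suc e) v ≡ true)

  elementsOf : Subset N → Subset n
  elementsOf C = tabulate λ v → Vec.lookup C (ix (element v))

  elementsOf⁺ : ∀ {C v} → ix (element v) ∈ C → v ∈ elementsOf C
  elementsOf⁺ v∈C = ∈-tabulate⁺ ([]=⇒lookup v∈C)

  elementsOf⁻ : ∀ {C v} → v ∈ elementsOf C → ix (element v) ∈ C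
  elementsOf⁻ v∈S = lookup⇒[]= _ _ (∈-tabulate⁻ v∈S)

  data Selected (S : Subset n) : Vertex m n → Set where
    middle  : ∀ {e w} → Selected S (middle e w)
    star    : ∀ {e} → Selected S (star e)
    element : ∀ {v} → v ∈ S → Selected S (element v)

  selects : Subset n → Vertex m n → Bool
  selects S (pendant _ _) = false
  selects S (middle _ _)  = true
  selects S (star _)      = true
  selects S (element v)   = Vec.lookup S v

  selects-sound : ∀ {S} u → selects S u ≡ true → Selected S u
  selects-sound (middle _ _) eq = middle
  selects-sound (star _)     eq = star
  selects-sound (element v)  eq = element (lookup⇒[]= v _ eq)

  selects-complete : ∀ {S u} → Selected S u → selects S u ≡ true
  selects-complete middle        = refl
  selects-complete star          = refl
  selects-complete (element v∈S) = []=⇒lookup v∈S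

  cover : Subset n → Subset N
  cover S = tabulate (selects S ∘ at)

  ∈-cover⁻ : ∀ {S i} → i ∈ cover S → Selected S (at i)
  ∈-cover⁻ {i = i} = selects-sound (at i) ∘ ∈-tabulate⁻

  ∈-cover⁺ : ∀ {S i} → Selected S (at i) → i ∈ cover S
  ∈-cover⁺ = ∈-tabulate⁺ ∘ selects-complete

  index-cover⁺ : ∀ {S u} → Selected S u → ix u ∈ cover S
  index-cover⁺ {S} {u} sel = ∈-cover⁺ (subst (Selected S) (sym (vertexAt-index u)) sel)

  element-cover⁻ : ∀ {S v} → ix (element v) ∈ cover S → v ∈ S
  element-cover⁻ {S} {v} v∈ with subst (Selected S) (vertexAt-index (element v)) (∈-cover⁻ v∈)
  ... | element v∈S = v∈S

  elementsOf-cover : ∀ S → elementsOf (cover S) ≡ S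
  elementsOf-cover S = ⊆-antisym
    (element-cover⁻ ∘ elementsOf⁻)
    (elementsOf⁺ ∘ index-cover⁺ ∘ element)

  module _ {C} (covers : IsVertexCover graph C) (connected : InducesConnected graph C) where

    private
      -- A cut argument: a path inside `C` stays on the side `P` or leaves it by a step that yields
      -- `R`. In the uses of `escape` below, `R` says which vertex of `C` the path leaves through.
      propagate : ∀ {P : Vertex m n → Set} {R : Set} →
        (∀ {u v} → P u → Joined u v → ix v ∈ C → P v ⊎ R) →
        ∀ {i j} → Star (AdjacentWithin graph C) i j → P (at i) → P (at j) ⊎ R
      propagate step ε Pi = inj₁ Pi
      propagate step (_◅_ {j = j} (_ , j∈C , ij) path) Pi
        with step Pi (adjacent⁻ ij) (subst (_∈ C) (sym (index-vertexAt j)) j∈C)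
      ... | inj₁ Pj = propagate step path Pj
      ... | inj₂ r  = inj₂ r

      escape : ∀ {P : Vertex m n → Set} {R : Set} →
        (∀ {u v} → P u → Joined u v → ix v ∈ C → P v ⊎ R) →
        ∀ {u v} → ix u ∈ C → ix v ∈ C → P u → ¬ P v → R
      escape {P} step {u} {v} u∈C v∈C Pu ¬Pv
        with propagate step (connected u∈C v∈C) (subst P (sym (vertexAt-index u)) Pu)
      ... | inj₁ Pv = contradiction (subst P (vertexAt-index v) Pv) ¬Pv
      ... | inj₂ r  = r

      covered : ∀ {u v} → Joined u v → ix u ∈ C ⊎ ix v ∈ C
      covered {u} {v} uv = covers (adjacent⁺ (subst₂ Joined (sym (vertexAt-index u))
        (sym (vertexAt-index v)) uv))

    -- If instead the pendant and the star cover the two edges, then both lie in `C`, and the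
    -- pendant reaches the star only through the middle vertex.
    middle∈ : ∀ e w → ix (middle e w) ∈ C
    middle∈ e w with covered (inj₁ (to-pendant {e} {w})) | covered (inj₁ (to-star {e} {w}))
    ... | inj₁ m∈ | _       = m∈
    ... | inj₂ _  | inj₁ m∈ = m∈
    ... | inj₂ p∈ | inj₂ s∈ = escape {P = _≡ pendant e w}
      (λ { refl (inj₂ to-pendant) m∈ → inj₂ m∈ }) p∈ s∈ refl (λ ())

    -- Columns 0 and 1 have no element, so the star is the only connection
    -- between them.
    star∈ : ∀ e → ix (star e) ∈ C
    star∈ e = escape step (middle∈ e zero) (middle∈ e (suc zero)) (inj₁ refl)
      (λ { (inj₁ ()) ; (inj₂ ()) })
      where
      P : Vertex m n → Set
      P u = u ≡ middle e zero ⊎ u ≡ pendant e zero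
      step : ∀ {u v} → P u → Joined u v → ix v ∈ C → P v ⊎ ix (star e) ∈ C
      step (inj₁ refl) (inj₁ to-pendant) _  = inj₁ (inj₂ refl)
      step (inj₁ refl) (inj₁ to-star)    s∈ = inj₂ s∈
      step (inj₂ refl) (inj₂ to-pendant) _  = inj₁ (inj₁ refl)

    -- A path from the star of the row to the star of row zero has to leave the row, and the only
    -- exits are elements of the hyperedge.
    elementsOf-hits : Hits (elementsOf C)
    elementsOf-hits e = escape step (star∈ (suc e)) (star∈ zero) star (λ ())
      where
      data OfRow : Vertex m n → Set where
        pendant : ∀ {w} → OfRow (pendant (suc e) w)
        middle  : ∀ {w} → OfRow (middle (suc e) w)
        star    : OfRow (star (suc e))
      step : ∀ {u v} → OfRow u → Joined u v → ix v ∈ C →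
        OfRow v ⊎ (∃[ v ] (v ∈ elementsOf C × incident (suc e) v ≡ true))
      step pendant (inj₂ to-pendant)       _  = inj₁ middle
      step middle  (inj₁ to-pendant)       _  = inj₁ pendant
      step middle  (inj₁ to-star)          _  = inj₁ star
      step middle  (inj₁ (to-element inc)) v∈ = inj₂ (_ , elementsOf⁺ v∈ , inc)
      step star    (inj₂ to-star)          _  = inj₁ middle

    cover-elementsOf⊆ : cover (elementsOf C) ⊆ C
    cover-elementsOf⊆ {i} i∈ = subst (_∈ C) (index-vertexAt i) (contains (∈-cover⁻ i∈))
      where
      contains : ∀ {u} → Selected (elementsOf C) u → ix u ∈ C
      contains (middle {e} {w}) = middle∈ e w
      contains (star {e})       = star∈ e
      contains (element v∈)     = elementsOf⁻ v∈

  -- All selected vertices reach the star of row zero: elements through their middle vertices in the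
  -- full row, every other row through an element that hits it.
  cover-connected : ∀ {S} → Hits S → IsConnectedVertexCover graph (cover S)
  cover-connected {S} hits = covers , λ {i} {j} i∈ j∈ → to-hub i∈ ◅◅ reverse flip (to-hub j∈)
    where
    Within = AdjacentWithin graph (cover S)

    flip : ∀ {i j} → Within i j → Within j i
    flip (i∈ , j∈ , ij) = j∈ , i∈ , Graph.symmetric graph ij

    end-selected : ∀ {u v} → Joined u v → Selected S u ⊎ Selected S v
    end-selected (inj₁ to-pendant)     = inj₁ middle
    end-selected (inj₁ to-star)        = inj₁ middle
    end-selected (inj₁ (to-element _)) = inj₁ middle
    end-selected (inj₂ to-pendant)     = inj₂ middle
    end-selected (inj₂ to-star)        = inj₂ middle
    end-selected (inj₂ (to-element _)) = inj₂ middle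

    covers : IsVertexCover graph (cover S)
    covers ij = Sum.map ∈-cover⁺ ∈-cover⁺ (end-selected (adjacent⁻ ij))

    link : ∀ {u v} → Selected S u → Selected S v → Joined u v → Within (ix u) (ix v)
    link {u} {v} u∈ v∈ uv = index-cover⁺ u∈ , index-cover⁺ v∈ ,
      adjacent⁺ (subst₂ Joined (sym (vertexAt-index u)) (sym (vertexAt-index v)) uv)

    hub = ix (star zero)

    element→hub : ∀ {v} → v ∈ S → Star Within (ix (element v)) hub
    element→hub {v} v∈ =
      link (element v∈) (middle {e = zero}) (inj₂ (to-element (full v))) ◅
      link middle star (inj₁ to-star) ◅ ε

    star→hub : ∀ e → Star Within (ix (star e)) hub
    star→hub zero    = ε
    star→hub (suc e) = let v , v∈ , inc = hits e in
      link star middle (inj₂ to-star) ◅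
      link (middle {w = suc (suc v)}) (element v∈) (inj₁ (to-element inc)) ◅
      element→hub v∈

    selected→hub : ∀ {u} → Selected S u → Star Within (ix u) hub
    selected→hub (middle {e}) = link middle star (inj₁ to-star) ◅ star→hub e
    selected→hub (star {e})   = star→hub e
    selected→hub (element v∈) = element→hub v∈

    to-hub : ∀ {i} → i ∈ cover S → Star Within i hub
    to-hub {i} i∈ = subst (λ j → Star Within j hub) (index-vertexAt i) (selected→hub (∈-cover⁻ i∈))

  module _ {C} (minimal : Minimal (IsConnectedVertexCover graph) C) where

    private
      covers    = proj₁ (proj₁ minimal)
      connected = proj₂ (proj₁ minimal)
      hits      = elementsOf-hits covers connected
      included  = cover-elementsOf⊆ covers connected

    -- The left side is itself a connected vertex cover and lies inside `C`, so it cannot be a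
    -- proper subset of the minimal `C`.
    cover-elementsOf : cover (elementsOf C) ≡ C
    cover-elementsOf = ⊆-antisym included λ {i} i∈ → backward i i∈
      where
      backward : ∀ i → i ∈ C → i ∈ cover (elementsOf C)
      backward i i∈ with i ∈? cover (elementsOf C)
      ... | yes i∈′ = i∈′
      ... | no  i∉  = contradiction (cover-connected hits)
        (proj₂ minimal _ (included , i , i∈ , i∉))

    elementsOf-minimal : Minimal Hits (elementsOf C)
    elementsOf-minimal = hits , λ { T (T⊆ , v , v∈ , v∉T) T-hits →
      proj₂ minimal (cover T)
        ( (λ i∈ → included (cover-mono T⊆ i∈))
        , ix (element v) , elementsOf⁻ v∈ , λ v∈′ → v∉T (element-cover⁻ v∈′))
        (cover-connected T-hits) }
      where
      selected-mono : ∀ {S T u} → S ⊆ T → Selected S u → Selected T u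
      selected-mono S⊆T middle       = middle
      selected-mono S⊆T star         = star
      selected-mono S⊆T (element v∈) = element (S⊆T v∈)
      cover-mono : ∀ {S T} → S ⊆ T → cover S ⊆ cover T
      cover-mono S⊆T = ∈-cover⁺ ∘ selected-mono S⊆T ∘ ∈-cover⁻

  -- A smaller connected vertex cover still has all middle and star vertices, so what it loses is an
  -- element, and its elements form a smaller hitting set.
  cover-minimal : ∀ {S} → Minimal Hits S → Minimal (IsConnectedVertexCover graph) (cover S)
  cover-minimal {S} (hits , minimal) = cover-connected hits , λ
    { D (D⊆ , i , i∈ , i∉D) (covers , connected) →
      let lost : ∀ {u} → Selected S u → ix u ∉ D → ∃[ v ] (v ∈ S × ix (element v) ∉ D)
          lost = λ { (middle {e} {w}) ∉D → contradiction (middle∈ covers connected e w) ∉D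
                   ; (star {e}) ∉D → contradiction (star∈ covers connected e) ∉D
                   ; (element v∈) ∉D → _ , v∈ , ∉D }
          v , v∈S , v∉D = lost (∈-cover⁻ i∈) (i∉D ∘ subst (_∈ D) (index-vertexAt i))
      in minimal (elementsOf D)
           ( (λ {x} x∈ → subst (x ∈_) (elementsOf-cover S) (elementsOf⁺ (D⊆ (elementsOf⁻ x∈))))
           , v , v∈S , v∉D ∘ elementsOf⁻)
           (elementsOf-hits covers connected) }

-- Lists encoded as trees

open ≡-Reasoning

lengthᵗ : Tree → ℕ
lengthᵗ nil     = 0
lengthᵗ (_ ∙ t) = suc (lengthᵗ t)

suffix : ℕ → Tree → Tree
suffix zero    t = t
suffix (suc i) t = suffix i (tail t)

lengthᵗ-suffix : ∀ i t → lengthᵗ (suffix i t) ≡ lengthᵗ t ∸ i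
lengthᵗ-suffix zero    t       = refl
lengthᵗ-suffix (suc i) nil     = trans (lengthᵗ-suffix i nil) (0∸n≡0 i)
lengthᵗ-suffix (suc i) (_ ∙ t) = lengthᵗ-suffix i t

lengthᵗ-encodeList : ∀ ts → lengthᵗ (encodeList ts) ≡ length ts
lengthᵗ-encodeList []       = refl
lengthᵗ-encodeList (_ ∷ ts) = cong suc (lengthᵗ-encodeList ts)

encodeList-++ : ∀ ts us → encodeList (ts ++ us) ≡ encodeList ts ⧺ encodeList us
encodeList-++ []       us = refl
encodeList-++ (t ∷ ts) us = cong (t ∙_) (encodeList-++ ts us)

head-suffix : ∀ {n} (f : Fin n → Tree) i → head (suffix (toℕ i) (encodeList (List.tabulate f))) ≡ f i
head-suffix f zero    = refl
head-suffix f (suc i) = head-suffix (f ∘ suc) i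

skip-along-++ : ∀ ts us vs → length ts ≡ length us →
  skip-along (encodeList ts) (encodeList (us ++ vs)) ≡ encodeList vs
skip-along-++ []       []       vs eq = refl
skip-along-++ (_ ∷ ts) (_ ∷ us) vs eq = skip-along-++ ts us vs (suc-injective eq)

skip-along-nil : ∀ s → skip-along s nil ≡ nil
skip-along-nil nil     = refl
skip-along-nil (_ ∙ s) = skip-along-nil s

concat-tabulate-[] : ∀ {A : Set} {n} (f : Fin n → A) →
  concat (List.tabulate (λ i → f i ∷ [])) ≡ List.tabulate f
concat-tabulate-[] {n = zero}  f = refl
concat-tabulate-[] {n = suc n} f = cong (f zero ∷_) (concat-tabulate-[] (f ∘ suc))

map-cartesianProductWith-tabulate : ∀ {A B C D : Set} (f : C → D) (c : A → B → C) {n}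
  (g : Fin n → A) bs →
  map f (cartesianProductWith c (List.tabulate g) bs) ≡
  concat (List.tabulate (λ i → map (f ∘ c (g i)) bs))
map-cartesianProductWith-tabulate f c {zero}  g bs = refl
map-cartesianProductWith-tabulate f c {suc n} g bs = trans (map-++ f (map (c (g zero)) bs) _)
  (cong₂ _++_ (sym (map-∘ bs)) (map-cartesianProductWith-tabulate f c (g ∘ suc) bs))

toList-tabulate : ∀ {A : Set} {n} (f : Fin n → A) → toList (Vec.tabulate f) ≡ List.tabulate f
toList-tabulate {n = zero}  f = refl
toList-tabulate {n = suc n} f = cong (f zero ∷_) (toList-tabulate (f ∘ suc))

tabulate∘lookup-list : ∀ {A B : Set} (f : A → B) xs → List.tabulate (f ∘ List.lookup xs) ≡ map f xs
tabulate∘lookup-list f xs = trans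
  (sym (map-tabulate (List.lookup xs) f))
  (cong (map f) (tabulate-lookup xs))

encodeSubset-tabulate : ∀ {n} (f : Fin n → Bool) →
  encodeSubset (Vec.tabulate f) ≡ encodeList (List.tabulate (encodeBool ∘ f))
encodeSubset-tabulate f = cong encodeList
  (trans (cong (map encodeBool) (toList-tabulate f)) (map-tabulate f encodeBool))

flat-tabulate : ∀ h e xs {n} (k : Fin n → List Tree) → lengthᵗ xs ≡ n →
  (∀ i → h (e ∙ suffix (toℕ i) xs) ≡ encodeList (k i)) →
  flat h e xs ≡ encodeList (concat (List.tabulate k))
flat-tabulate h e nil      k refl eq = refl
flat-tabulate h e (x ∙ xs) k refl eq = trans
  (cong₂ _⧺_ (eq zero) (flat-tabulate h e xs (k ∘ suc) refl (eq ∘ suc)))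
  (sym (encodeList-++ (k zero) _))

flat-tabulate-[] : ∀ h e xs {n} (k : Fin n → Tree) → lengthᵗ xs ≡ n →
  (∀ i → h (e ∙ suffix (toℕ i) xs) ≡ k i ∙ nil) →
  flat h e xs ≡ encodeList (List.tabulate k)
flat-tabulate-[] h e xs k len eq = trans (flat-tabulate h e xs (λ i → k i ∷ []) len eq)
  (cong encodeList (concat-tabulate-[] k))

-- In contrast to `flat-tabulate`, this is for bodies that look only at the first element of the
-- suffix.
flat-map : ∀ {A : Set} h e (d k : A → Tree) as →
  (∀ a t → h (e ∙ (d a ∙ t)) ≡ k a ∙ nil) →
  flat h e (encodeList (map d as)) ≡ encodeList (map k as)
flat-map h e d k []       eq = refl
flat-map h e d k (a ∷ as) eq = cong₂ _⧺_ (eq a _) (flat-map h e d k as eq)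

constᶠ : ∀ t → PolyTime (λ _ → t)
constᶠ nil     = nilᶠ
constᶠ (s ∙ t) = constᶠ s ∙ᶠ constᶠ t

trueᵗ : Tree
trueᵗ = encodeBool true

same-length : Tree → Tree → Tree
same-length s t = cond (skip-along s t) nil (cond (skip-along t s) nil trueᵗ)

same-length-correct : ∀ s t → same-length s t ≡ encodeBool (lengthᵗ s ≡ᵇ lengthᵗ t)
same-length-correct nil     nil     = refl
same-length-correct nil     (_ ∙ t) = refl
same-length-correct (_ ∙ s) nil     rewrite skip-along-nil s = refl
same-length-correct (_ ∙ s) (_ ∙ t) = same-length-correct s t

same-lengthᶠ : ∀ {f g} → PolyTime f → PolyTime g → PolyTime (λ t → same-length (f t) (g t))
same-lengthᶠ F G = condᶠ (skip-alongᶠ F G) nilᶠ (condᶠ (skip-alongᶠ G F) nilᶠ (constᶠ trueᵗ))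

-- Within lists of a common length, a suffix is located by its own length. So positions in different
-- lists, such as columns of two rows, can be compared.
same-length-suffix : ∀ {n s t} (i j : Fin n) → lengthᵗ s ≡ n ∸ toℕ i → lengthᵗ t ≡ n ∸ toℕ j →
  same-length s t ≡ encodeBool (does (i Fin.≟ j))
same-length-suffix {n} {s} {t} i j s≡ t≡ = begin
  same-length s t
    ≡⟨ same-length-correct s t ⟩
  encodeBool (lengthᵗ s ≡ᵇ lengthᵗ t)
    ≡⟨ cong₂ (λ a b → encodeBool (a ≡ᵇ b)) s≡ t≡ ⟩
  encodeBool (n ∸ toℕ i ≡ᵇ n ∸ toℕ j)
    ≡⟨ cong encodeBool (does-⇔ (mk⇔ cancel (cong (λ k → n ∸ toℕ k)))
         (n ∸ toℕ i ≟ n ∸ toℕ j) (i Fin.≟ j)) ⟩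
  encodeBool (does (i Fin.≟ j)) ∎
  where
  cancel : n ∸ toℕ i ≡ n ∸ toℕ j → i ≡ j
  cancel = Fin.toℕ-injective ∘ ∸-cancelˡ-≡ (<⇒≤ (Fin.toℕ<n i)) (<⇒≤ (Fin.toℕ<n j))

cond-∧ : ∀ a b → cond (encodeBool a) (encodeBool b) nil ≡ encodeBool (a ∧ b)
cond-∧ true  b = refl
cond-∧ false b = refl

cond-∨ : ∀ a b → cond (encodeBool a) trueᵗ (encodeBool b) ≡ encodeBool (a ∨ b)
cond-∨ true  b = refl
cond-∨ false b = refl

-- Computing the graph from the encoding of the hypergraph

-- A vertex is described by its kind, its row and its column; rows and columns
-- are suffixes of the list of rows, of a row, or of the unary order.
kind rowOf columnOf : Tree → Tree
kind     = head
rowOf    = head ∘ tail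
columnOf = tail ∘ tail

pendantKind middleKind starKind elementKind : Tree
pendantKind = encodeUnary 0
middleKind  = encodeUnary 1
starKind    = encodeUnary 2
elementKind = encodeUnary 3

-- Kinds are unary numbers, told apart by testing successive tails. The head of a column suffix is
-- the incidence bit.
edgeᵗ : Tree → Tree
edgeᵗ t =
  cond (kind u)
    (cond (tail (kind u)) nil
      (cond (kind v)
        (cond (tail (kind v))
          (cond (tail (tail (kind v)))
            (cond (same-length (columnOf u) (columnOf v)) (head (columnOf u)) nil)
            (same-length (rowOf u) (rowOf v)))
          nil)
        (cond (same-length (rowOf u) (rowOf v)) (same-length (columnOf u) (columnOf v)) nil)))
    nil
  where
  u = head t
  v = tail t

edgeᶠ : PolyTime edgeᵗ
edgeᶠ =
  condᶠ (headᶠ u)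
    (condᶠ (tailᶠ (headᶠ u)) nilᶠ
      (condᶠ (headᶠ v)
        (condᶠ (tailᶠ (headᶠ v))
          (condᶠ (tailᶠ (tailᶠ (headᶠ v)))
            (condᶠ columns (headᶠ (tailᶠ (tailᶠ u))) nilᶠ)
            rows)
          nilᶠ)
        (condᶠ rows columns nilᶠ)))
    nilᶠ
  where
  u       = headᶠ idᶠ
  v       = tailᶠ idᶠ
  rows    = same-lengthᶠ (headᶠ (tailᶠ u)) (headᶠ (tailᶠ v))
  columns = same-lengthᶠ (tailᶠ (tailᶠ u)) (tailᶠ (tailᶠ v))

joinedᵗ : Tree → Tree
joinedᵗ t = cond (edgeᵗ (head t ∙ tail t)) trueᵗ (edgeᵗ (tail t ∙ head t))

joinedᶠ : PolyTime joinedᵗ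
joinedᶠ = condᶠ (edgeᶠ ∘ᶠ (headᶠ idᶠ ∙ᶠ tailᶠ idᶠ)) (constᶠ trueᵗ)
  (edgeᶠ ∘ᶠ (tailᶠ idᶠ ∙ᶠ headᶠ idᶠ))

-- The environment of the outer loop is the whole vertex list, that of the inner loop the current
-- vertex.
entryᵗ lineᵗ matrixᵗ : Tree → Tree
entryᵗ t  = joinedᵗ (head t ∙ head (tail t)) ∙ nil
lineᵗ t   = flat entryᵗ (head (tail t)) (head t) ∙ nil
matrixᵗ t = flat lineᵗ t t

matrixᶠ : PolyTime matrixᵗ
matrixᶠ = flatᶠ
  (flatᶠ ((joinedᶠ ∘ᶠ (headᶠ idᶠ ∙ᶠ headᶠ (tailᶠ idᶠ))) ∙ᶠ nilᶠ)
    (headᶠ (tailᶠ idᶠ)) (headᶠ idᶠ) ∙ᶠ nilᶠ)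
  idᶠ idᶠ

-- The two leading `nil` entries of each row are the zero bits of the dummy columns. The first row
-- is the full hyperedge, with one true bit for each cell of the unary order.
rowsᵗ : Tree → Tree
rowsᵗ t = (nil ∙ nil ∙ flat (λ _ → trueᵗ ∙ nil) nil (head t)) ∙
  flat (λ s → (nil ∙ nil ∙ head (tail s)) ∙ nil) nil (tail t)

rowsᶠ : PolyTime rowsᵗ
rowsᶠ = (nilᶠ ∙ᶠ nilᶠ ∙ᶠ flatᶠ (constᶠ trueᵗ ∙ᶠ nilᶠ) nilᶠ (headᶠ idᶠ)) ∙ᶠ
  flatᶠ ((nilᶠ ∙ᶠ nilᶠ ∙ᶠ headᶠ (tailᶠ idᶠ)) ∙ᶠ nilᶠ) nilᶠ (tailᶠ idᶠ)

-- The inner body receives its environment, a suffix of the rows, paired with a suffix of the row.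
-- This is already row and column of a description, so only the kind is put in front.
productᵗ : Tree → Tree → Tree
productᵗ k t = flat (λ s → flat (λ r → (k ∙ r) ∙ nil) (tail s) (head (tail s))) nil t

productᶠ : ∀ k → PolyTime (productᵗ k)
productᶠ k = flatᶠ
  (flatᶠ ((constᶠ k ∙ᶠ idᶠ) ∙ᶠ nilᶠ) (tailᶠ idᶠ) (headᶠ (tailᶠ idᶠ))) nilᶠ idᶠ

starsᵗ : Tree → Tree
starsᵗ t = flat (λ s → (starKind ∙ tail s ∙ nil) ∙ nil) nil t

starsᶠ : PolyTime starsᵗ
starsᶠ = flatᶠ ((constᶠ starKind ∙ᶠ tailᶠ idᶠ ∙ᶠ nilᶠ) ∙ᶠ nilᶠ) nilᶠ idᶠ

elementsᵗ : Tree → Tree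
elementsᵗ t = flat (λ s → (elementKind ∙ s) ∙ nil) nil t

elementsᶠ : PolyTime elementsᵗ
elementsᶠ = flatᶠ ((constᶠ elementKind ∙ᶠ idᶠ) ∙ᶠ nilᶠ) nilᶠ idᶠ

othersᵗ : Tree → Tree
othersᵗ t = productᵗ pendantKind t ⧺ productᵗ middleKind t ⧺ starsᵗ t

othersᶠ : PolyTime othersᵗ
othersᶠ = ⧺ᶠ (productᶠ pendantKind) (⧺ᶠ (productᶠ middleKind) starsᶠ)

-- The parameter is the list of all vertices but the elements; the decoder uses it as a unary
-- number.
prepareᵗ : Tree → Tree
prepareᵗ t = othersᵗ (rowsᵗ t) ∙ matrixᵗ (othersᵗ (rowsᵗ t) ⧺ elementsᵗ (head t))

prepareᶠ : PolyTime prepareᵗ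
prepareᶠ = (othersᶠ ∘ᶠ rowsᶠ) ∙ᶠ
  (matrixᶠ ∘ᶠ ⧺ᶠ (othersᶠ ∘ᶠ rowsᶠ) (elementsᶠ ∘ᶠ headᶠ idᶠ))

-- Correctness of the computed graph and of the decoder

module _ (H : Hypergraph) where
  open Hypergraph H renaming (order to n)

  private
    m = length edges

  incidence : Fin (suc m) → Fin n → Bool
  incidence zero    v = true
  incidence (suc e) v = Vec.lookup (List.lookup edges e) v

  module Gadget = Construction (numbering m n) incidence (λ _ → refl)

  private
    row : Fin (suc m) → Tree
    row e = nil ∙ nil ∙ encodeList (List.tabulate (encodeBool ∘ incidence e))

    rows unary : Tree
    rows  = encodeList (List.tabulate row)
    unary = encodeUnary n

    lengthᵗ-tabulate : ∀ {n} (f : Fin n → Tree) → lengthᵗ (encodeList (List.tabulate f)) ≡ n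
    lengthᵗ-tabulate f = trans (lengthᵗ-encodeList (List.tabulate f)) (length-tabulate f)

    lengthᵗ-unary : lengthᵗ unary ≡ n
    lengthᵗ-unary = trans (lengthᵗ-encodeList (List.replicate n nil)) (length-replicate n)

    lengthᵗ-row : ∀ e → lengthᵗ (row e) ≡ 2 + n
    lengthᵗ-row e = cong (2 +_) (lengthᵗ-tabulate _)

  describe : Vertex m n → Tree
  describe (pendant e w) = pendantKind ∙ suffix (toℕ e) rows ∙ suffix (toℕ w) (row e)
  describe (middle e w)  = middleKind ∙ suffix (toℕ e) rows ∙ suffix (toℕ w) (row e)
  describe (star e)      = starKind ∙ suffix (toℕ e) rows ∙ nil
  describe (element v)   = elementKind ∙ nil ∙ suffix (toℕ v) unary

  private
    same-row : ∀ e e′ → same-length (suffix (toℕ e) rows) (suffix (toℕ e′) rows) ≡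
      encodeBool (does (e Fin.≟ e′))
    same-row e e′ = same-length-suffix e e′ (len e) (len e′)
      where
      len : ∀ e → lengthᵗ (suffix (toℕ e) rows) ≡ suc m ∸ toℕ e
      len e = trans (lengthᵗ-suffix (toℕ e) rows) (cong (_∸ toℕ e) (lengthᵗ-tabulate row))

    length-column : ∀ e w → lengthᵗ (suffix (toℕ w) (row e)) ≡ 2 + n ∸ toℕ {2 + n} w
    length-column e w = trans (lengthᵗ-suffix (toℕ w) (row e)) (cong (_∸ toℕ w) (lengthᵗ-row e))

    edgeᵗ-describe : ∀ u v → edgeᵗ (describe u ∙ describe v) ≡ encodeBool (Gadget.isEdge u v)
    edgeᵗ-describe (pendant _ _) v = refl
    edgeᵗ-describe (star _)      v = refl
    edgeᵗ-describe (element _)   v = refl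
    edgeᵗ-describe (middle e w) (middle e′ w′) = refl
    edgeᵗ-describe (middle e w) (pendant e′ w′) = trans
      (cong₂ (λ a b → cond a b nil) (same-row e e′)
        (same-length-suffix w w′ (length-column e w) (length-column e′ w′)))
      (cond-∧ (does (e Fin.≟ e′)) (does (w Fin.≟ w′)))
    edgeᵗ-describe (middle e w) (star e′) = same-row e e′
    edgeᵗ-describe (middle e w) (element v) = trans
      (cong (λ a → cond a (head (suffix (toℕ w) (row e))) nil)
        -- The unary order is two cells shorter than a row, so its suffix at `v` is as long as a
        -- row's suffix at `suc (suc v)`, the column of `v`.
        (same-length-suffix w (suc (suc v)) (length-column e w)
          (trans (lengthᵗ-suffix (toℕ v) unary) (cong (_∸ toℕ v) lengthᵗ-unary))))
      bit
      where
      bit : cond (encodeBool (does (w Fin.≟ suc (suc v)))) (head (suffix (toℕ w) (row e))) nil ≡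
            encodeBool (does (w Fin.≟ suc (suc v)) ∧ incidence e v)
      bit with w Fin.≟ suc (suc v)
      ... | yes refl = head-suffix (encodeBool ∘ incidence e) v
      ... | no _     = refl

    joinedᵗ-describe : ∀ u v → joinedᵗ (describe u ∙ describe v) ≡ encodeBool (Gadget.joined u v)
    joinedᵗ-describe u v = trans
      (cong₂ (λ a b → cond a trueᵗ b) (edgeᵗ-describe u v) (edgeᵗ-describe v u))
      (cond-∨ (Gadget.isEdge u v) (Gadget.isEdge v u))

    matrixᵗ-describe : matrixᵗ (encodeList (map describe (vertices m n))) ≡ encodeGraph Gadget.graph
    matrixᵗ-describe = begin
      matrixᵗ (encodeList (map describe vs))
        ≡⟨ flat-map lineᵗ _ describe (λ u → encodeList (map (encodeBool ∘ Gadget.joined u) vs)) vs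
             (λ u _ → cong (_∙ nil) (flat-map entryᵗ _ describe (encodeBool ∘ Gadget.joined u) vs
               (λ v _ → cong (_∙ nil) (joinedᵗ-describe u v)))) ⟩
      encodeList (map (λ u → encodeList (map (encodeBool ∘ Gadget.joined u) vs)) vs)
        ≡⟨ cong encodeList
             (tabulate∘lookup-list (λ u → encodeList (map (encodeBool ∘ Gadget.joined u) vs)) vs) ⟨
      encodeList (List.tabulate λ i →
        encodeList (map (encodeBool ∘ Gadget.joined (List.lookup vs i)) vs))
        ≡⟨ cong encodeList (tabulate-cong λ i → trans
             (cong encodeList
               (sym (tabulate∘lookup-list (encodeBool ∘ Gadget.joined (List.lookup vs i)) vs)))
             (sym (encodeSubset-tabulate (λ j → Gadget.joined (List.lookup vs i) (List.lookup vs j))))) ⟩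
      encodeList (List.tabulate λ i → encodeSubset (Gadget.adjacency i))
        ≡⟨ cong encodeList (toList-tabulate (encodeSubset ∘ Gadget.adjacency)) ⟨
      encodeGraph Gadget.graph ∎
      where vs = vertices m n

    rowsᵗ-encode : rowsᵗ (encodeHypergraph H) ≡ rows
    rowsᵗ-encode = cong₂ _∙_
      (cong (λ t → nil ∙ nil ∙ t)
        (flat-tabulate-[] (λ _ → trueᵗ ∙ nil) nil unary (λ _ → trueᵗ) lengthᵗ-unary (λ _ → refl)))
      (begin
        flat _ nil (encodeList (map encodeSubset edges))
          ≡⟨ flat-map _ nil encodeSubset (λ S → nil ∙ nil ∙ encodeSubset S) edges (λ _ _ → refl) ⟩
        encodeList (map (λ S → nil ∙ nil ∙ encodeSubset S) edges)
          ≡⟨ cong encodeList (tabulate∘lookup-list (λ S → nil ∙ nil ∙ encodeSubset S) edges) ⟨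
        encodeList (List.tabulate λ e → nil ∙ nil ∙ encodeSubset (List.lookup edges e))
          ≡⟨ cong encodeList (tabulate-cong λ e → cong (λ t → nil ∙ nil ∙ t)
               (trans (cong encodeSubset (sym (tabulate∘lookup (List.lookup edges e))))
                 (encodeSubset-tabulate (incidence (suc e))))) ⟩
        encodeList (List.tabulate (row ∘ suc)) ∎)

    productᵗ-describe : ∀ k (c : Fin (suc m) → Fin (2 + n) → Vertex m n) →
      (∀ e w → k ∙ suffix (toℕ e) rows ∙ suffix (toℕ w) (row e) ≡ describe (c e w)) →
      productᵗ k rows ≡
      encodeList (map describe (cartesianProductWith c (allFin (suc m)) (allFin (2 + n))))
    productᵗ-describe k c eq = trans
      (flat-tabulate (λ s → flat (λ r → (k ∙ r) ∙ nil) (tail s) (head (tail s))) nil rows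
        (λ e → map (describe ∘ c e) (allFin (2 + n))) (lengthᵗ-tabulate row) λ e → begin
        flat (λ r → (k ∙ r) ∙ nil) (suffix (toℕ e) rows) (head (suffix (toℕ e) rows))
          ≡⟨ cong (flat (λ r → (k ∙ r) ∙ nil) (suffix (toℕ e) rows)) (head-suffix row e) ⟩
        flat (λ r → (k ∙ r) ∙ nil) (suffix (toℕ e) rows) (row e)
          ≡⟨ flat-tabulate-[] (λ r → (k ∙ r) ∙ nil) _ (row e) (describe ∘ c e) (lengthᵗ-row e)
               (λ w → cong (_∙ nil) (eq e w)) ⟩
        encodeList (List.tabulate (describe ∘ c e))
          ≡⟨ cong encodeList (map-tabulate id (describe ∘ c e)) ⟨
        encodeList (map (describe ∘ c e) (allFin (2 + n))) ∎)
      (cong encodeList (sym (map-cartesianProductWith-tabulate describe c id (allFin (2 + n)))))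

    map-describe-tabulate : ∀ {l} (c : Fin l → Vertex m n) →
      List.tabulate (describe ∘ c) ≡ map describe (map c (allFin l))
    map-describe-tabulate c = trans (sym (map-tabulate c describe))
      (cong (map describe) (sym (map-tabulate id c)))

    starsᵗ-describe : starsᵗ rows ≡ encodeList (map describe (stars m n))
    starsᵗ-describe = trans
      (flat-tabulate-[] (λ s → (starKind ∙ tail s ∙ nil) ∙ nil) nil rows
        (describe ∘ star) (lengthᵗ-tabulate row) (λ _ → refl))
      (cong encodeList (map-describe-tabulate star))

    elementsᵗ-describe : elementsᵗ unary ≡ encodeList (map describe (elements m n))
    elementsᵗ-describe = trans
      (flat-tabulate-[] (λ s → (elementKind ∙ s) ∙ nil) nil unary
        (describe ∘ element) lengthᵗ-unary (λ _ → refl))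
      (cong encodeList (map-describe-tabulate element))

    encode-⧺ : ∀ us vs → encodeList (map describe us) ⧺ encodeList (map describe vs) ≡
      encodeList (map describe (us ++ vs))
    encode-⧺ us vs = trans (sym (encodeList-++ (map describe us) (map describe vs)))
      (cong encodeList (sym (map-++ describe us vs)))

    othersᵗ-describe : othersᵗ rows ≡ encodeList (map describe (others m n))
    othersᵗ-describe = trans
      (cong₂ _⧺_ (productᵗ-describe pendantKind pendant (λ _ _ → refl))
        (trans
          (cong₂ _⧺_ (productᵗ-describe middleKind middle (λ _ _ → refl)) starsᵗ-describe)
          (encode-⧺ (middles m n) (stars m n))))
      (encode-⧺ (pendants m n) (middles m n ++ stars m n))

  prepareᵗ-encode : prepareᵗ (encodeHypergraph H) ≡
    encodeList (map describe (others m n)) ∙ encodeGraph Gadget.graph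
  prepareᵗ-encode = cong₂ _∙_ others≡ (begin
    matrixᵗ (othersᵗ (rowsᵗ (encodeHypergraph H)) ⧺ elementsᵗ unary)
      ≡⟨ cong matrixᵗ (cong₂ _⧺_ others≡ elementsᵗ-describe) ⟩
    matrixᵗ (encodeList (map describe (others m n)) ⧺ encodeList (map describe (elements m n)))
      ≡⟨ cong matrixᵗ (encode-⧺ (others m n) (elements m n)) ⟩
    matrixᵗ (encodeList (map describe (vertices m n)))
      ≡⟨ matrixᵗ-describe ⟩
    encodeGraph Gadget.graph ∎)
    where
    others≡ = trans (cong othersᵗ rowsᵗ-encode) othersᵗ-describe

  -- Listed in vertex order, the bits of `C` are those of `others` followed by those of `elements`;
  -- the parameter has exactly the length of the first block.
  decode-elementsOf : ∀ C → skip-along (encodeList (map describe (others m n))) (encodeSubset C) ≡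
    encodeSubset (Gadget.elementsOf C)
  decode-elementsOf C = begin
    skip-along (encodeList (map describe (others m n))) (encodeSubset C)
      ≡⟨ cong (skip-along (encodeList (map describe (others m n)))) bits ⟩
    skip-along (encodeList (map describe (others m n)))
      (encodeList (map bit (others m n) ++ map bit (elements m n)))
      ≡⟨ skip-along-++ (map describe (others m n)) (map bit (others m n)) _
           (trans (length-map describe (others m n)) (sym (length-map bit (others m n)))) ⟩
    encodeList (map bit (elements m n))
      ≡⟨ cong encodeList (trans (sym (map-∘ (allFin n))) (map-tabulate id (bit ∘ element))) ⟩
    encodeList (List.tabulate (bit ∘ element))
      ≡⟨ encodeSubset-tabulate (λ v → Vec.lookup C (index (element v))) ⟨
    encodeSubset (Gadget.elementsOf C) ∎
    where
    open Numbering (numbering m n)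
    bit : Vertex m n → Tree
    bit u = encodeBool (Vec.lookup C (index u))
    bits : encodeSubset C ≡ encodeList (map bit (others m n) ++ map bit (elements m n))
    bits = begin
      encodeSubset C
        ≡⟨ cong encodeSubset (tabulate∘lookup C) ⟨
      encodeSubset (Vec.tabulate (Vec.lookup C))
        ≡⟨ encodeSubset-tabulate (Vec.lookup C) ⟩
      encodeList (List.tabulate (encodeBool ∘ Vec.lookup C))
        ≡⟨ cong encodeList (tabulate-cong λ i → cong (encodeBool ∘ Vec.lookup C) (index-vertexAt i)) ⟨
      encodeList (List.tabulate (bit ∘ List.lookup (vertices m n)))
        ≡⟨ cong encodeList (tabulate∘lookup-list bit (vertices m n)) ⟩
      encodeList (map bit (vertices m n))
        ≡⟨ cong encodeList (map-++ bit (others m n) (elements m n)) ⟩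
      encodeList (map bit (others m n) ++ map bit (elements m n)) ∎

  hits⇒transversal : ∀ {S} → Gadget.Hits S → IsTransversal H S
  hits⇒transversal {S} hits {e} e∈ =
    let v , v∈S , inc = hits (Any.index e∈)
    in v , x∈p∩q⁺ (subst (v ∈_) (sym (lookup-index e∈)) (lookup⇒[]= v _ inc) , v∈S)

  transversal⇒hits : ∀ {S} → IsTransversal H S → Gadget.Hits S
  transversal⇒hits {S} transversal e =
    let v , v∈ = transversal (∈-lookup e)
        v∈e , v∈S = x∈p∩q⁻ (List.lookup edges e) S v∈
    in v , v∈S , []=⇒lookup v∈e

-- The reduction from minimal transversals

Minimal-map : ∀ {n} {P Q : Subset n → Set} → (∀ {S} → P S → Q S) → (∀ {S} → Q S → P S) →
  ∀ {S} → Minimal P S → Minimal Q S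
Minimal-map P⇒Q Q⇒P (PS , minimal) = P⇒Q PS , λ T T⊂S QT → minimal T T⊂S (Q⇒P QT)

order≤size : ∀ G → Graph.order G ≤ size (encodeGraph G)
order≤size G = vector (Vec.tabulate (encodeSubset ∘ Graph.neighbours G))
  where
  vector : ∀ {n} (ts : Vec Tree n) → n ≤ size (encodeList (toList ts))
  vector []       = z≤n
  vector (t ∷ ts) = s≤s (≤-trans (vector ts) (m≤n+m _ (size t)))

reduction : Reduction MinimalTransversals (MinimalConnectedVertexCovers TwoDegenerateBipartite)
reduction = record
  { prepareᶠ       = prepareᶠ
  ; decodeᶠ        = skip-alongᶠ (headᶠ idᶠ) (tailᶠ idᶠ)
  ; transform      = λ H → Gadget.graph H , Gadget.two-degenerate H , Gadget.bipartite H
  ; parameter      = λ H → encodeList (map (describe H) (others _ _))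
  ; prepare-encode = prepareᵗ-encode
  ; ground≤        = λ H → order≤size (Gadget.graph H)
  ; to             = Gadget.elementsOf
  ; from           = Gadget.cover
  ; decode-encode  = decode-elementsOf
  ; to-solution    = λ H minimal → Minimal-map (hits⇒transversal H) (transversal⇒hits H)
                       (Gadget.elementsOf-minimal H minimal)
  ; from-solution  = λ H minimal → Gadget.cover-minimal H
                       (Minimal-map (transversal⇒hits H) (hits⇒transversal H) minimal)
  ; to-from        = Gadget.elementsOf-cover
  ; from-to        = λ H → Gadget.cover-elementsOf H
  }

theorem4 : (HasOutputPolynomialAlgorithm (MinimalConnectedVertexCovers TwoDegenerateBipartite) →
    HasOutputPolynomialAlgorithm MinimalTransversals) ×
    (HasPolynomialDelayAlgorithm (MinimalConnectedVertexCovers TwoDegenerateBipartite) →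
    HasPolynomialDelayAlgorithm MinimalTransversals)
theorem4 = output-polynomial reduction , polynomial-delay reduction
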